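{- For scheduling with testing on a single machine minimizing $\sum_j C_j$, the randomized algorithm Random (defined in the context) with parameters $T\approx 1.7453$ and $E\approx 2.8609$ has competitive ratio at most $1.7453$, i.e. $E[\mathrm{Random}(I)]\le 1.7453\cdot\mathrm{Opt}(I)$ for every instance $I$.
   Context: Scheduling with testing: an instance consists of $n$ jobs to be processed on a single machine. Each job $j$ has an upper limit $\bar p_j\in\mathbb{Q}^+$ and a processing time $p_j$ with $0\le p_j\le \bar p_j$. At any time the machine either tests a job or executes a job. A job can be executed untested, which takes time $\bar p_j$; or it can be tested, which takes one unit of time and reveals $p_j$, and then it can be executed at any later time, which takes time $p_j$. Initially an algorithm knows only the $\bar p_j$; $p_j$ becomes known only when $j$ is tested. $C_j$ is the completion time of job $j$, $\mathrm{Opt}(I)$ is the optimal value of $\sum_jC_j$ for instance $I$ (with all $p_j$ known). A randomized algorithm has competitive ratio at most $\rho$ if $E[\mathrm{Alg}(I)]\le \rho\,\mathrm{Opt}(I)$ for all instances $I$. Algorithm Random with parameters $1\le T\le E$: (1) execute untested all jobs with $\bar p_j<T$ in order of increasing $\bar p_j$; (2) test all jobs with $\bar p_j\ge T$ in a uniformly random order, executing each tested job $j$ immediately after its test if $p_j\le E$ and deferring it otherwise; (3) execute all deferred jobs in order of increasing processing time. The paper specifies the parameters only numerically as $T\approx1.7453$, $E\approx2.8609$. -}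

module Defs where

open import Data.Bool using (Bool; true; false; if_then_else_)
open import Data.Nat using (ℕ; suc)
open import Data.Integer using (ℤ)
open import Data.Fin using (Fin)
import Data.Fin.Properties as FinP
open import Data.List using (List; []; _∷_; _++_; map; concatMap; filter; length; foldr; allFin)
open import Data.List.Membership.Propositional using (_∈_)
open import Data.List.Relation.Unary.Unique.Propositional using (Unique)
import Data.List.Membership.DecPropositional as DecMem
open import Data.Product using (_×_; _,_; ∃₂)
open import Relation.Nullary using (does; Dec)
open import Relation.Binary.PropositionalEquality using (_≡_)
open import Data.Rational using (ℚ; 0ℚ; 1ℚ; _+_; _*_; _/_; _≤_; _<_; _≤?_; _<?_)
open import Data.Rational.Properties using (≤-decTotalOrder)
open import Data.List.Sort ≤-decTotalOrder using (sort)

record Instance (n : ℕ) : Set where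
  field
    pbar    : Fin n → ℚ
    p       : Fin n → ℚ
    pbar>0  : ∀ j → 0ℚ < pbar j
    p≥0     : ∀ j → 0ℚ ≤ p j
    p≤pbar  : ∀ j → p j ≤ pbar j

-- General (offline) schedules: a sequence of machine operations,
-- processed back to back starting at time 0.

data Op (n : ℕ) : Set where
  test : Fin n → Op n
  exec : Fin n → Op n

Feasible : {n : ℕ} → List (Op n) → Set
Feasible {n} ops =
  Unique ops ×
  (∀ (j : Fin n) → exec j ∈ ops) ×
  (∀ (j : Fin n) → test j ∈ ops →
     ∃₂ λ xs ys → ops ≡ xs ++ ys × test j ∈ xs × exec j ∈ ys)

_∈Fin?_ : {n : ℕ} (j : Fin n) (xs : List (Fin n)) → Dec (j ∈ xs)
_∈Fin?_ {n} = DecMem._∈?_ (FinP._≟_ {n})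

sumCOps : {n : ℕ} → Instance n → List (Fin n) → ℚ → List (Op n) → ℚ
sumCOps I tested t [] = 0ℚ
sumCOps I tested t (test j ∷ ops) = sumCOps I (j ∷ tested) (t + 1ℚ) ops
sumCOps I tested t (exec j ∷ ops) =
  let t' = t + (if does (j ∈Fin? tested) then Instance.p I j else Instance.pbar I j)
  in t' + sumCOps I tested t' ops

cost : {n : ℕ} → Instance n → List (Op n) → ℚ
cost I ops = sumCOps I [] 0ℚ ops

-- Sum of completion times for a sequence of time blocks, each of a given
-- length and flagged with whether a job completes at its end.
sumCBlocks : ℚ → List (ℚ × Bool) → ℚ
sumCBlocks t [] = 0ℚ
sumCBlocks t ((d , b) ∷ bs) = (if b then t + d else 0ℚ) + sumCBlocks (t + d) bs

insertions : {A : Set} → A → List A → List (List A)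
insertions x [] = (x ∷ []) ∷ []
insertions x (y ∷ ys) = (x ∷ y ∷ ys) ∷ map (y ∷_) (insertions x ys)

permutations : {A : Set} → List A → List (List A)
permutations [] = [] ∷ []
permutations (x ∷ xs) = concatMap (insertions x) (permutations xs)

sumℚ : List ℚ → ℚ
sumℚ = foldr _+_ 0ℚ

mean : List ℚ → ℚ
mean [] = 0ℚ
mean (x ∷ xs) = sumℚ (x ∷ xs) * (Data.Integer.+ 1 / suc (length xs))

module Random {n : ℕ} (I : Instance n) (T E : ℚ) where
  open Instance I

  small : List (Fin n)          -- p̄_j < T : executed untested
  small = filter (λ j → pbar j <? T) (allFin n)

  large : List (Fin n)          -- p̄_j ≥ T : tested
  large = filter (λ j → T ≤? pbar j) (allFin n)

  deferred : List (Fin n)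
  deferred = filter (λ j → E <? p j) large

  phase2 : Fin n → List (ℚ × Bool)
  phase2 j = (1ℚ , false) ∷ (if does (p j ≤? E) then (p j , true) ∷ [] else [])

  blocks : List (Fin n) → List (ℚ × Bool)
  blocks σ =
    map (λ x → (x , true)) (sort (map pbar small)) ++
    concatMap phase2 σ ++
    map (λ x → (x , true)) (sort (map p deferred))

  costFor : List (Fin n) → ℚ
  costFor σ = sumCBlocks 0ℚ (blocks σ)

  expected : ℚ
  expected = mean (map costFor (permutations large))

Tparam Eparam ρ : ℚ
Tparam = Data.Integer.+ 17453 / 10000
Eparam = Data.Integer.+ 28609 / 10000
ρ = Data.Integer.+ 17453 / 10000

{-# OPTIONS --safe #-}

-- Doubling all costs turns both sides into quadratic forms in the jobs.  In an arbitrary schedule job j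
-- takes time at least q j = min (p̄ j) (1 + p j), so twice its cost is at least ∑ q i + ∑∑ min (q i) (q j).
-- Twice the expected cost of Random is computed exactly by pairing every test order with its reverse.
-- Untested jobs are fine pair by pair, as are pairs of deferred jobs up to a constant.  For the tested
-- jobs executed at once write ∑∑ min (q i) (q j) = ∫ G², where G t is the number of q i above t, and bound
-- G² ≥ 2 g G - g² with a constant g on each of [0, 1], [1, T] and [T, E].  The best constants leave an
-- inequality between quadratic forms in three counts, which is proved by completing squares.

module Submission where

open import Defs
open import Data.Bool using (Bool; true; false; if_then_else_)
open import Data.Fin using (Fin)
import Data.Fin.Properties as Fin
import Data.Integer as ℤ
import Data.Integer.Properties as ℤ
open import Data.List using (List; []; _∷_; _∷ʳ_; _++_; map; concatMap; filter; length; reverse; allFin)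
open import Data.List.Membership.Propositional using (_∈_)
open import Data.List.Membership.Propositional.Properties using (∈-allFin)
open import Data.List.Membership.Propositional.Properties.WithK using (unique∧set⇒bag)
open import Data.List.Properties using (unfold-reverse)
open import Data.List.Relation.Binary.BagAndSetEquality using (∼bag⇒↭)
open import Data.List.Relation.Binary.Permutation.Propositional as ↭
  using (_↭_; ↭-sym; ↭-trans; ↭-refl; prep; swap)
open import Data.List.Relation.Binary.Permutation.Propositional.Properties
  using (↭-reverse; shift; ++⁺ˡ; All-resp-↭)
open import Data.List.Relation.Unary.All as All using (All; []; _∷_)
import Data.List.Relation.Unary.All.Properties as All
open import Data.List.Relation.Unary.AllPairs using (AllPairs; []; _∷_)
open import Data.List.Relation.Unary.Any using (here; there)
open import Data.List.Relation.Unary.Sorted.TotalOrder.Properties using (Sorted⇒AllPairs)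
open import Data.List.Relation.Unary.Unique.Propositional using (Unique)
open import Data.List.Relation.Unary.Unique.Propositional.Properties using (allFin⁺)
open import Data.Nat as ℕ using (ℕ)
import Data.Nat.Properties as ℕ
open import Data.Product using (_×_; _,_; proj₁; proj₂; ∃₂)
open import Data.Rational
open import Data.Rational.Properties
open import Data.List.Sort ≤-decTotalOrder using (sort; sort-↭; sort-↗)
import Data.Rational.Unnormalised as ℚᵘ
import Data.Rational.Unnormalised.Properties as ℚᵘ
open import Data.Sum using (inj₁; inj₂)
open import Function using (_∘_; id; mk⇔)
open import Relation.Binary.Bundles using (DecTotalOrder)
open import Relation.Binary.PropositionalEquality
  using (_≡_; _≢_; refl; sym; trans; cong; cong₂; subst; module ≡-Reasoning)
open import Relation.Nullary using (does; Dec; yes; no; ¬_; contradiction)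
open import Relation.Nullary.Decidable using (dec⇒maybe; toWitness)
open import Relation.Unary using (Decidable)
open import Tactic.RingSolver using (solve-∀)
open import Tactic.RingSolver.Core.AlmostCommutativeRing using (AlmostCommutativeRing; fromCommutativeRing)

-- The obstacle is a pair of tested jobs of different sizes. Take `p i = 0` with `pbar i` at least
-- `T`, and `p j = pbar j = E`: the pair contributes `1 + (1 + E)`, about 4.86, to twice the
-- expected cost, but only 2 to the bound on twice the optimum, so the ratio 1.7453 fails for this
-- pair alone. Pairs of similar sizes leave slack, and that slack has to pay. Hence the tested jobs
-- need one inequality for the whole form instead of one per pair. Replacing `G²` by a linear
-- function of `G` suits this: once the numbers of jobs of each kind are fixed, the cost of the
-- early jobs is linear in their sizes, so the sizes survive only as total excesses in the two
-- layers, with linear coefficients. The free constants can then be chosen to make these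
-- coefficients zero or of the right sign.

private
  variable
    A B : Set


-- Order and sign facts for rationals

ℚ-ring : AlmostCommutativeRing _ _
ℚ-ring = fromCommutativeRing +-*-commutativeRing (λ x → dec⇒maybe (0ℚ ≟ x))

0≤1 : 0ℚ ≤ 1ℚ
0≤1 = toWitness {a? = 0ℚ ≤? 1ℚ} _

0≤+ : ∀ {x y} → 0ℚ ≤ x → 0ℚ ≤ y → 0ℚ ≤ x + y
0≤+ = +-mono-≤

0≤* : ∀ {x y} → 0ℚ ≤ x → 0ℚ ≤ y → 0ℚ ≤ x * y
0≤* {x} {y} 0≤x 0≤y =
  subst (_≤ x * y) (*-zeroʳ x) (*-monoˡ-≤-nonNeg x {{nonNegative 0≤x}} 0≤y)

0≤square : ∀ x → 0ℚ ≤ x * x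
0≤square x with ≤-total 0ℚ x
... | inj₁ 0≤x = 0≤* 0≤x 0≤x
... | inj₂ x≤0 =
  subst (_≤ x * x) (*-zeroʳ x) (*-monoˡ-≤-nonPos x {{nonPositive x≤0}} x≤0)

x≤y⇒0≤y-x : ∀ {x y} → x ≤ y → 0ℚ ≤ y - x
x≤y⇒0≤y-x {x} {y} x≤y = subst (_≤ y - x) (+-inverseʳ x) (+-monoˡ-≤ (- x) x≤y)

0≤y-x⇒x≤y : ∀ {x y} → 0ℚ ≤ y - x → x ≤ y
0≤y-x⇒x≤y {x} {y} 0≤y-x = begin
  x            ≡⟨ +-identityˡ x ⟨
  0ℚ + x       ≤⟨ +-monoˡ-≤ x 0≤y-x ⟩
  y - x + x    ≡⟨ cancel x y ⟩
  y            ∎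
  where
  open ≤-Reasoning
  cancel : ∀ x y → y - x + x ≡ y
  cancel = solve-∀ ℚ-ring

x≤x+y : ∀ {x y} → 0ℚ ≤ y → x ≤ x + y
x≤x+y {x} {y} 0≤y = subst (_≤ x + y) (+-identityʳ x) (+-monoʳ-≤ x 0≤y)

0≤-resp : ∀ {x y} → y ≡ x → 0ℚ ≤ x → 0ℚ ≤ y
0≤-resp y≡x = subst (0ℚ ≤_) (sym y≡x)

0≤-cancelˡ : ∀ c {x} → 0ℚ < c → 0ℚ ≤ c * x → 0ℚ ≤ x
0≤-cancelˡ c {x} 0<c 0≤cx =
  *-cancelˡ-≤-pos c {{positive 0<c}} (subst (_≤ c * x) (sym (*-zeroʳ c)) 0≤cx)

-- Finite sums

∑ : (A → ℚ) → List A → ℚ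
∑ f []       = 0ℚ
∑ f (x ∷ xs) = f x + ∑ f xs

∑∑ : (A → B → ℚ) → List A → List B → ℚ
∑∑ K xs ys = ∑ (λ x → ∑ (K x) ys) xs

count : List A → ℚ
count = ∑ (λ _ → 1ℚ)

∑-cong : {f g : A → ℚ} (xs : List A) → (∀ x → f x ≡ g x) → ∑ f xs ≡ ∑ g xs
∑-cong []       f≡g = refl
∑-cong (x ∷ xs) f≡g = cong₂ _+_ (f≡g x) (∑-cong xs f≡g)

∑-mono : {f g : A → ℚ} {xs : List A} → All (λ x → f x ≤ g x) xs → ∑ f xs ≤ ∑ g xs
∑-mono []            = ≤-refl
∑-mono (fx≤gx ∷ f≤g) = +-mono-≤ fx≤gx (∑-mono f≤g)

∑-nonneg : {f : A → ℚ} {xs : List A} → All (λ x → 0ℚ ≤ f x) xs → 0ℚ ≤ ∑ f xs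
∑-nonneg []           = ≤-refl
∑-nonneg (0≤fx ∷ 0≤f) = 0≤+ 0≤fx (∑-nonneg 0≤f)

0≤count : (xs : List A) → 0ℚ ≤ count xs
0≤count xs = ∑-nonneg (All.universal (λ _ → <⇒≤ (positive⁻¹ 1ℚ)) xs)

∑-map : (f : B → ℚ) (g : A → B) (xs : List A) → ∑ f (map g xs) ≡ ∑ (f ∘ g) xs
∑-map f g []       = refl
∑-map f g (x ∷ xs) = cong (f (g x) +_) (∑-map f g xs)

∑-++ : (f : A → ℚ) (xs ys : List A) → ∑ f (xs ++ ys) ≡ ∑ f xs + ∑ f ys
∑-++ f []       ys = sym (+-identityˡ _)
∑-++ f (x ∷ xs) ys = trans (cong (f x +_) (∑-++ f xs ys)) (sym (+-assoc (f x) _ _))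

∑-↭ : (f : A → ℚ) {xs ys : List A} → xs ↭ ys → ∑ f xs ≡ ∑ f ys
∑-↭ f ↭.refl            = refl
∑-↭ f (↭.prep x p)      = cong (f x +_) (∑-↭ f p)
∑-↭ f (↭.swap x y p)    = trans (exchange (f x) (f y) _) (cong (λ s → f y + (f x + s)) (∑-↭ f p))
  where
  exchange : ∀ a b c → a + (b + c) ≡ b + (a + c)
  exchange = solve-∀ ℚ-ring
∑-↭ f (↭.trans p q)     = trans (∑-↭ f p) (∑-↭ f q)

∑-+ : (f g : A → ℚ) (xs : List A) → ∑ (λ x → f x + g x) xs ≡ ∑ f xs + ∑ g xs
∑-+ f g []       = refl
∑-+ f g (x ∷ xs) = trans (cong ((f x + g x) +_) (∑-+ f g xs)) (interchange (f x) (g x) _ _)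
  where
  interchange : ∀ a b c d → (a + b) + (c + d) ≡ (a + c) + (b + d)
  interchange = solve-∀ ℚ-ring

∑-*ˡ : (c : ℚ) (f : A → ℚ) (xs : List A) → ∑ (λ x → c * f x) xs ≡ c * ∑ f xs
∑-*ˡ c f []       = sym (*-zeroʳ c)
∑-*ˡ c f (x ∷ xs) = trans (cong (c * f x +_) (∑-*ˡ c f xs)) (sym (*-distribˡ-+ c _ _))

∑-const : (c : ℚ) (xs : List A) → ∑ (λ _ → c) xs ≡ c * count xs
∑-const c xs = trans (∑-cong xs (λ _ → sym (*-identityʳ c))) (∑-*ˡ c (λ _ → 1ℚ) xs)

∑-filter : {P : A → Set} (P? : Decidable P) (f : A → ℚ) (xs : List A) →
           ∑ (λ x → if does (P? x) then f x else 0ℚ) xs ≡ ∑ f (filter P? xs)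
∑-filter P? f []       = refl
∑-filter P? f (x ∷ xs) with does (P? x)
... | true  = cong (f x +_) (∑-filter P? f xs)
... | false = trans (+-identityˡ _) (∑-filter P? f xs)

filter-++-↭ : {P Q : A → Set} (P? : Decidable P) (Q? : Decidable Q) →
              (∀ x → P x → ¬ Q x) → (∀ x → ¬ P x → Q x) →
              (xs : List A) → xs ↭ filter P? xs ++ filter Q? xs
filter-++-↭ P? Q? P⇒¬Q ¬P⇒Q []       = ↭-refl
filter-++-↭ P? Q? P⇒¬Q ¬P⇒Q (x ∷ xs) with P? x | Q? x
... | yes Px | yes Qx = contradiction Qx (P⇒¬Q x Px)
... | yes Px | no _   = prep x (filter-++-↭ P? Q? P⇒¬Q ¬P⇒Q xs)
... | no _   | yes Qx = ↭-trans (prep x (filter-++-↭ P? Q? P⇒¬Q ¬P⇒Q xs)) (↭-sym (shift x (filter P? xs) _))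
... | no ¬Px | no ¬Qx = contradiction (¬P⇒Q x ¬Px) ¬Qx

∑∑-mono : {K L : A → B → ℚ} {xs : List A} {ys : List B} →
          All (λ x → All (λ y → K x y ≤ L x y) ys) xs → ∑∑ K xs ys ≤ ∑∑ L xs ys
∑∑-mono K≤L = ∑-mono (All.map ∑-mono K≤L)

∑∑-↭ : (K : A → A → ℚ) {xs ys : List A} → xs ↭ ys → ∑∑ K xs xs ≡ ∑∑ K ys ys
∑∑-↭ K {xs} p = trans (∑-cong xs (λ x → ∑-↭ (K x) p)) (∑-↭ _ p)

∑∑-comm : {K : A → A → ℚ} → (∀ x y → K x y ≡ K y x) → (xs ys : List A) → ∑∑ K xs ys ≡ ∑∑ K ys xs
∑∑-comm {K = K} K-comm []       ys = sym (trans (∑-const 0ℚ ys) (*-zeroˡ (count ys)))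
∑∑-comm {K = K} K-comm (x ∷ xs) ys = begin
  ∑ (K x) ys + ∑∑ K xs ys              ≡⟨ cong₂ _+_ (∑-cong ys (K-comm x)) (∑∑-comm K-comm xs ys) ⟩
  ∑ (λ y → K y x) ys + ∑∑ K ys xs      ≡⟨ ∑-+ (λ y → K y x) (λ y → ∑ (K y) xs) ys ⟨
  ∑∑ K ys (x ∷ xs)                     ∎
  where open ≡-Reasoning

∑∑-++ : {K : A → A → ℚ} → (∀ x y → K x y ≡ K y x) → (xs ys : List A) →
        ∑∑ K (xs ++ ys) (xs ++ ys) ≡ ∑∑ K xs xs + (∑∑ K xs ys + ∑∑ K xs ys) + ∑∑ K ys ys
∑∑-++ {K = K} K-comm xs ys = begin
  ∑∑ K (xs ++ ys) (xs ++ ys)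
    ≡⟨ ∑-cong (xs ++ ys) (λ x → ∑-++ (K x) xs ys) ⟩
  ∑ (λ x → ∑ (K x) xs + ∑ (K x) ys) (xs ++ ys)
    ≡⟨ ∑-+ (λ x → ∑ (K x) xs) (λ x → ∑ (K x) ys) (xs ++ ys) ⟩
  ∑∑ K (xs ++ ys) xs + ∑∑ K (xs ++ ys) ys
    ≡⟨ cong₂ _+_ (∑-++ _ xs ys) (∑-++ _ xs ys) ⟩
  (∑∑ K xs xs + ∑∑ K ys xs) + (∑∑ K xs ys + ∑∑ K ys ys)
    ≡⟨ cong (λ s → (∑∑ K xs xs + s) + (∑∑ K xs ys + ∑∑ K ys ys)) (∑∑-comm K-comm ys xs) ⟩
  (∑∑ K xs xs + ∑∑ K xs ys) + (∑∑ K xs ys + ∑∑ K ys ys)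
    ≡⟨ rearrange (∑∑ K xs xs) (∑∑ K xs ys) (∑∑ K ys ys) ⟩
  ∑∑ K xs xs + (∑∑ K xs ys + ∑∑ K xs ys) + ∑∑ K ys ys ∎
  where
  open ≡-Reasoning
  rearrange : ∀ a b c → (a + b) + (b + c) ≡ a + (b + b) + c
  rearrange = solve-∀ ℚ-ring

∑∑-∷ : {K : A → A → ℚ} → (∀ x y → K x y ≡ K y x) → (x : A) (xs : List A) →
       ∑∑ K (x ∷ xs) (x ∷ xs) ≡ K x x + (∑ (K x) xs + ∑ (K x) xs) + ∑∑ K xs xs
∑∑-∷ {K = K} K-comm x xs = trans (∑∑-++ K-comm (x ∷ []) xs)
  (cong (_+ ∑∑ K xs xs) (cong₂ _+_ (unit² (K x x)) (cong₂ _+_ (+-identityʳ (∑ (K x) xs)) (+-identityʳ (∑ (K x) xs)))))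
  where
  unit² : ∀ a → (a + 0ℚ) + 0ℚ ≡ a
  unit² = solve-∀ ℚ-ring

∑∑-+ : (K L : A → B → ℚ) (xs : List A) (ys : List B) →
       ∑∑ (λ x y → K x y + L x y) xs ys ≡ ∑∑ K xs ys + ∑∑ L xs ys
∑∑-+ K L xs ys = trans (∑-cong xs (λ x → ∑-+ (K x) (L x) ys)) (∑-+ (λ x → ∑ (K x) ys) (λ x → ∑ (L x) ys) xs)

∑∑-*ˡ : (c : ℚ) (K : A → B → ℚ) (xs : List A) (ys : List B) → ∑∑ (λ x y → c * K x y) xs ys ≡ c * ∑∑ K xs ys
∑∑-*ˡ c K xs ys = trans (∑-cong xs (λ x → ∑-*ˡ c (K x) ys)) (∑-*ˡ c (λ x → ∑ (K x) ys) xs)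

∑∑-constʳ : (f : A → ℚ) (xs : List A) (ys : List B) → ∑∑ (λ x _ → f x) xs ys ≡ count ys * ∑ f xs
∑∑-constʳ f xs ys = trans (∑-cong xs (λ x → trans (∑-const (f x) ys) (*-comm (f x) (count ys)))) (∑-*ˡ (count ys) f xs)

-- The kernel x ⊓ y

∑∑⊓ : List ℚ → ℚ
∑∑⊓ xs = ∑∑ _⊓_ xs xs

sort-AllPairs : (xs : List ℚ) → AllPairs _≤_ (sort xs)
sort-AllPairs xs = Sorted⇒AllPairs (DecTotalOrder.totalOrder ≤-decTotalOrder) (sort-↗ xs)

∑-⊓-minimal : {x : ℚ} {xs : List ℚ} → All (x ≤_) xs → ∑ (x ⊓_) xs ≡ x * count xs
∑-⊓-minimal {x} []                   = sym (*-zeroʳ x)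
∑-⊓-minimal {x} {y ∷ ys} (x≤y ∷ x≤ys) = begin
  x ⊓ y + ∑ (x ⊓_) ys    ≡⟨ cong₂ _+_ (p≤q⇒p⊓q≡p x≤y) (∑-⊓-minimal x≤ys) ⟩
  x + x * count ys       ≡⟨ cong (_+ x * count ys) (*-identityʳ x) ⟨
  x * 1ℚ + x * count ys  ≡⟨ *-distribˡ-+ x 1ℚ (count ys) ⟨
  x * (1ℚ + count ys)    ∎
  where open ≡-Reasoning

∑-⊓-≤ : (x : ℚ) (xs : List ℚ) → ∑ (x ⊓_) xs ≤ x * count xs
∑-⊓-≤ x xs = subst (∑ (x ⊓_) xs ≤_) (∑-const x xs) (∑-mono (All.universal (p⊓q≤p x) xs))

∑∑⊓-∷ : (x : ℚ) (xs : List ℚ) → ∑∑⊓ (x ∷ xs) ≡ x + (∑ (x ⊓_) xs + ∑ (x ⊓_) xs) + ∑∑⊓ xs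
∑∑⊓-∷ x xs = trans (∑∑-∷ ⊓-comm x xs)
  (cong (λ a → a + (∑ (x ⊓_) xs + ∑ (x ⊓_) xs) + ∑∑⊓ xs) (⊓-idem x))

-- With G t the number of entries above t, ∑∑⊓ xs = ∫₀ᴸ G², ∑ id xs = ∫₀ᴸ G, and G is count xs
-- on [0, m]: the bound is ∫₀ᴸ (G - g)² ≥ ∫₀ᵐ (G - g)².
∑∑⊓-sorted-level : (g : ℚ) {L m : ℚ} {xs : List ℚ} → m ≤ L → All (m ≤_) xs → All (_≤ L) xs → AllPairs _≤_ xs →
  m * ((count xs - g) * (count xs - g)) ≤ ∑∑⊓ xs - (g + g) * ∑ id xs + g * g * L
∑∑⊓-sorted-level g {L} {m} {[]} m≤L [] [] [] =
  0≤y-x⇒x≤y (0≤-resp (lemma g L m) (0≤* (0≤square g) (x≤y⇒0≤y-x m≤L)))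
  where
  lemma : ∀ g L m → 0ℚ - (g + g) * 0ℚ + g * g * L - m * ((0ℚ - g) * (0ℚ - g)) ≡ g * g * (L - m)
  lemma = solve-∀ ℚ-ring
∑∑⊓-sorted-level g {L} {m} {x ∷ xs} m≤L (m≤x ∷ m≤xs) (x≤L ∷ xs≤L) (x≤xs ∷ xs↗) = begin
  m * ((1ℚ + n - g) * (1ℚ + n - g))
    ≤⟨ *-monoʳ-≤-nonNeg _ {{nonNegative (0≤square (1ℚ + n - g))}} m≤x ⟩
  x * ((1ℚ + n - g) * (1ℚ + n - g))
    ≡⟨ expand x n g ⟩
  x * ((n - g) * (n - g)) + (x + (x * n + x * n) - (g + g) * x)
    -- The lower limit moves from `m` to `x`, which bounds all remaining entries from below. The
    -- square on the left carries the count through the induction; at `m = 0` it disappears.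
    ≤⟨ +-monoˡ-≤ _ (∑∑⊓-sorted-level g x≤L x≤xs xs≤L xs↗) ⟩
  ∑∑⊓ xs - (g + g) * ∑ id xs + g * g * L + (x + (x * n + x * n) - (g + g) * x)
    ≡⟨ collect (∑∑⊓ xs) g (∑ id xs) L x (x * n) ⟩
  x + (x * n + x * n) + ∑∑⊓ xs - (g + g) * (x + ∑ id xs) + g * g * L
    ≡⟨ cong (λ a → x + (a + a) + ∑∑⊓ xs - (g + g) * (x + ∑ id xs) + g * g * L) (∑-⊓-minimal x≤xs) ⟨
  x + (∑ (x ⊓_) xs + ∑ (x ⊓_) xs) + ∑∑⊓ xs - (g + g) * (x + ∑ id xs) + g * g * L
    ≡⟨ cong (λ a → a - (g + g) * (x + ∑ id xs) + g * g * L) (∑∑⊓-∷ x xs) ⟨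
  ∑∑⊓ (x ∷ xs) - (g + g) * (x + ∑ id xs) + g * g * L ∎
  where
  open ≤-Reasoning
  n = count xs
  expand : ∀ x n g → x * ((1ℚ + n - g) * (1ℚ + n - g)) ≡ x * ((n - g) * (n - g)) + (x + (x * n + x * n) - (g + g) * x)
  expand = solve-∀ ℚ-ring
  collect : ∀ s g t L x xn → s - (g + g) * t + g * g * L + (x + (xn + xn) - (g + g) * x)
          ≡ x + (xn + xn) + s - (g + g) * (x + t) + g * g * L
  collect = solve-∀ ℚ-ring

∑∑⊓-level : (g : ℚ) {L : ℚ} {xs : List ℚ} → 0ℚ ≤ L → All (0ℚ ≤_) xs → All (_≤ L) xs →
  (g + g) * ∑ id xs - g * g * L ≤ ∑∑⊓ xs
∑∑⊓-level g {L} {xs} 0≤L 0≤xs xs≤L = begin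
  (g + g) * ∑ id xs - g * g * L            ≡⟨ cong (λ a → (g + g) * a - g * g * L) (∑-↭ id (sort-↭ xs)) ⟨
  (g + g) * ∑ id (sort xs) - g * g * L     ≤⟨ 0≤y-x⇒x≤y (0≤-resp (lemma g L (∑∑⊓ (sort xs)) (∑ id (sort xs)))
                                               (≤-trans (≤-reflexive (sym (*-zeroˡ ((count (sort xs) - g) * (count (sort xs) - g)))))
                                                 (∑∑⊓-sorted-level g 0≤L (All-resp-↭ (↭-sym (sort-↭ xs)) 0≤xs)
                                                   (All-resp-↭ (↭-sym (sort-↭ xs)) xs≤L) (sort-AllPairs xs)))) ⟩
  ∑∑⊓ (sort xs)                            ≡⟨ ∑∑-↭ _⊓_ (sort-↭ xs) ⟩
  ∑∑⊓ xs                                   ∎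
  where
  open ≤-Reasoning
  lemma : ∀ g L s t → s - ((g + g) * t - g * g * L) ≡ s - (g + g) * t + g * g * L
  lemma = solve-∀ ℚ-ring

-- Total completion time of a fixed sequence

completions : ℚ → List ℚ → ℚ
completions t xs = sumCBlocks t (map (λ x → (x , true)) xs)

private
  completions-step : ∀ t x n s c c′ k →
    (t + t) * (1ℚ + n) + (x + s) + (x + (k + k) + c) + (c′ - ((t + x + (t + x)) * n + s + c) + (x * n - k + (x * n - k)))
    ≡ (t + x) + (t + x) + c′
  completions-step = solve-∀ ℚ-ring

  double-+ : ∀ a b → (a + b) + (a + b) ≡ a + a + (b + b)
  double-+ = solve-∀ ℚ-ring

-- In twice the total completion time a pair of entries contributes twice the length of the one that
-- comes first, which is at least twice the smaller length. For a sorted list the first is the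
-- smaller, whence the equality in `completions-sorted`.
completions-lower : (t : ℚ) (xs : List ℚ) →
  (t + t) * count xs + ∑ id xs + ∑∑⊓ xs ≤ completions t xs + completions t xs
completions-lower t []       = ≤-reflexive (lemma t)
  where
  lemma : ∀ t → (t + t) * 0ℚ + 0ℚ + 0ℚ ≡ 0ℚ + 0ℚ
  lemma = solve-∀ ℚ-ring
completions-lower t (x ∷ xs) = begin
  (t + t) * (1ℚ + n) + (x + s) + ∑∑⊓ (x ∷ xs)
    ≡⟨ cong ((t + t) * (1ℚ + n) + (x + s) +_) (∑∑⊓-∷ x xs) ⟩
  (t + t) * (1ℚ + n) + (x + s) + (x + (k + k) + ∑∑⊓ xs)
    ≤⟨ x≤x+y (0≤+ (x≤y⇒0≤y-x (completions-lower (t + x) xs)) (0≤+ 0≤k 0≤k)) ⟩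
  (t + t) * (1ℚ + n) + (x + s) + (x + (k + k) + ∑∑⊓ xs) + (c + c - ((t + x + (t + x)) * n + s + ∑∑⊓ xs) + (x * n - k + (x * n - k)))
    ≡⟨ completions-step t x n s (∑∑⊓ xs) (c + c) k ⟩
  (t + x) + (t + x) + (c + c)
    ≡⟨ double-+ (t + x) c ⟨
  completions t (x ∷ xs) + completions t (x ∷ xs) ∎
  where
  open ≤-Reasoning
  n = count xs
  s = ∑ id xs
  k = ∑ (x ⊓_) xs
  c = completions (t + x) xs
  0≤k = x≤y⇒0≤y-x (∑-⊓-≤ x xs)

completions-sorted : (t : ℚ) {xs : List ℚ} → AllPairs _≤_ xs →
  completions t xs + completions t xs ≡ (t + t) * count xs + ∑ id xs + ∑∑⊓ xs
completions-sorted t []       = lemma t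
  where
  lemma : ∀ t → 0ℚ + 0ℚ ≡ (t + t) * 0ℚ + 0ℚ + 0ℚ
  lemma = solve-∀ ℚ-ring
completions-sorted t {x ∷ xs} (x≤xs ∷ xs↗) = begin
  ((t + x) + c) + ((t + x) + c)
    ≡⟨ double-+ (t + x) c ⟩
  (t + x) + (t + x) + (c + c)
    ≡⟨ cong ((t + x) + (t + x) +_) (completions-sorted (t + x) xs↗) ⟩
  (t + x) + (t + x) + ((t + x + (t + x)) * n + s + ∑∑⊓ xs)
    ≡⟨ lemma t x n s (∑∑⊓ xs) ⟩
  (t + t) * (1ℚ + n) + (x + s) + (x + (x * n + x * n) + ∑∑⊓ xs)
    ≡⟨ cong (λ a → (t + t) * (1ℚ + n) + (x + s) + (x + (a + a) + ∑∑⊓ xs)) (∑-⊓-minimal x≤xs) ⟨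
  (t + t) * (1ℚ + n) + (x + s) + (x + (∑ (x ⊓_) xs + ∑ (x ⊓_) xs) + ∑∑⊓ xs)
    ≡⟨ cong ((t + t) * (1ℚ + n) + (x + s) +_) (∑∑⊓-∷ x xs) ⟨
  (t + t) * (1ℚ + n) + (x + s) + ∑∑⊓ (x ∷ xs) ∎
  where
  open ≡-Reasoning
  n = count xs
  s = ∑ id xs
  c = completions (t + x) xs
  lemma : ∀ t x n s c → (t + x) + (t + x) + ((t + x + (t + x)) * n + s + c)
        ≡ (t + t) * (1ℚ + n) + (x + s) + (x + (x * n + x * n) + c)
  lemma = solve-∀ ℚ-ring

∑∑⊓-map : (f : A → ℚ) (xs : List A) → ∑∑⊓ (map f xs) ≡ ∑∑ (λ x y → f x ⊓ f y) xs xs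
∑∑⊓-map f xs = trans (∑-map _ f xs) (∑-cong xs (λ x → ∑-map (f x ⊓_) f xs))

-- Each size splits as `1 + v + v′`, its parts in [0, 1], [1, r] and [r, E], and the sum of the
-- minima of the parts is at most the minimum of the sums. On [0, 1] all sizes are present, so that
-- layer gives the square of the count exactly; the other two get `∑∑⊓-level` with independent
-- constants.
∑∑⊓-layers : (u : A → ℚ) {r E : ℚ} {xs : List A} → 1ℚ ≤ r → r ≤ E →
  All (λ x → 1ℚ ≤ u x) xs → All (λ x → u x ≤ E) xs → (g₂ g₃ : ℚ) →
    count xs * count xs
  + ((g₂ + g₂) * ∑ (λ x → u x ⊓ r - 1ℚ) xs - g₂ * g₂ * (r - 1ℚ))
  + ((g₃ + g₃) * ∑ (λ x → u x - u x ⊓ r) xs - g₃ * g₃ * (E - r))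
  ≤ ∑∑ (λ x y → u x ⊓ u y) xs xs
∑∑⊓-layers u {r} {E} {xs} 1≤r r≤E 1≤u u≤E g₂ g₃ = begin
  count xs * count xs + level g₂ v (r - 1ℚ) + level g₃ v′ (E - r)
    ≤⟨ +-mono-≤ (+-monoʳ-≤ (count xs * count xs) (layer v (x≤y⇒0≤y-x 1≤r) 0≤v v≤ g₂))
                (layer v′ (x≤y⇒0≤y-x r≤E) 0≤v′ v′≤ g₃) ⟩
  count xs * count xs + ∑∑ (λ x y → v x ⊓ v y) xs xs + ∑∑ (λ x y → v′ x ⊓ v′ y) xs xs
    ≡⟨ cong (λ a → a + ∑∑ (λ x y → v x ⊓ v y) xs xs + ∑∑ (λ x y → v′ x ⊓ v′ y) xs xs)
            (∑∑-constʳ (λ _ → 1ℚ) xs xs) ⟨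
  ∑∑ (λ _ _ → 1ℚ) xs xs + ∑∑ (λ x y → v x ⊓ v y) xs xs + ∑∑ (λ x y → v′ x ⊓ v′ y) xs xs
    ≡⟨ cong (_+ ∑∑ (λ x y → v′ x ⊓ v′ y) xs xs) (∑∑-+ _ _ xs xs) ⟨
  ∑∑ (λ x y → 1ℚ + v x ⊓ v y) xs xs + ∑∑ (λ x y → v′ x ⊓ v′ y) xs xs
    ≡⟨ ∑∑-+ _ _ xs xs ⟨
  ∑∑ (λ x y → 1ℚ + v x ⊓ v y + v′ x ⊓ v′ y) xs xs
    ≤⟨ ∑∑-mono (All.universal (λ x → All.universal (λ y → ⊓-glb
         (≤-trans (+-mono-≤ (+-monoʳ-≤ 1ℚ (p⊓q≤p (v x) (v y))) (p⊓q≤p (v′ x) (v′ y)))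
                  (≤-reflexive (layers (u x) (u x ⊓ r))))
         (≤-trans (+-mono-≤ (+-monoʳ-≤ 1ℚ (p⊓q≤q (v x) (v y))) (p⊓q≤q (v′ x) (v′ y)))
                  (≤-reflexive (layers (u y) (u y ⊓ r)))))
         xs) xs) ⟩
  ∑∑ (λ x y → u x ⊓ u y) xs xs ∎
  where
  open ≤-Reasoning
  v v′ : _ → ℚ
  v x  = u x ⊓ r - 1ℚ
  v′ x = u x - u x ⊓ r
  level : ℚ → (_ → ℚ) → ℚ → ℚ
  level g v L = (g + g) * ∑ v xs - g * g * L
  layers : ∀ u m → 1ℚ + (m - 1ℚ) + (u - m) ≡ u
  layers = solve-∀ ℚ-ring
  0≤v : All (λ x → 0ℚ ≤ v x) xs
  0≤v = All.map (λ 1≤ux → x≤y⇒0≤y-x (⊓-glb 1≤ux 1≤r)) 1≤u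
  v≤ : All (λ x → v x ≤ r - 1ℚ) xs
  v≤ = All.universal (λ x → +-monoˡ-≤ (- 1ℚ) (p⊓q≤q (u x) r)) xs
  0≤v′ : All (λ x → 0ℚ ≤ v′ x) xs
  0≤v′ = All.universal (λ x → x≤y⇒0≤y-x (p⊓q≤p (u x) r)) xs
  excess : ∀ a → a ≤ E → a - a ⊓ r ≤ E - r
  excess a a≤E with ≤-total a r
  ... | inj₁ a≤r rewrite p≤q⇒p⊓q≡p a≤r = ≤-trans (≤-reflexive (+-inverseʳ a)) (x≤y⇒0≤y-x r≤E)
  ... | inj₂ r≤a rewrite p≥q⇒p⊓q≡q r≤a = +-monoˡ-≤ (- r) a≤E
  v′≤ : All (λ x → v′ x ≤ E - r) xs
  v′≤ = All.map (λ {x} → excess (u x)) u≤E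
  layer : (v : _ → ℚ) {L : ℚ} → 0ℚ ≤ L → All (λ x → 0ℚ ≤ v x) xs → All (λ x → v x ≤ L) xs →
          (g : ℚ) → level g v L ≤ ∑∑ (λ x y → v x ⊓ v y) xs xs
  layer v {L} 0≤L 0≤v v≤L g = begin
    (g + g) * ∑ v xs - g * g * L            ≡⟨ cong (λ a → (g + g) * a - g * g * L) (∑-map id v xs) ⟨
    (g + g) * ∑ id (map v xs) - g * g * L   ≤⟨ ∑∑⊓-level g 0≤L (All.map⁺ 0≤v) (All.map⁺ v≤L) ⟩
    ∑∑⊓ (map v xs)                          ≡⟨ ∑∑⊓-map v xs ⟩
    ∑∑ (λ x y → v x ⊓ v y) xs xs            ∎

-- Permutations and means

∑-concatMap : (f : B → ℚ) (g : A → List B) (xs : List A) → ∑ f (concatMap g xs) ≡ ∑ (λ x → ∑ f (g x)) xs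
∑-concatMap f g []       = refl
∑-concatMap f g (x ∷ xs) = trans (∑-++ f (g x) (concatMap g xs)) (cong (∑ f (g x) +_) (∑-concatMap f g xs))

-- `insertions` recurses from the front, while `reverse` turns the front into the back. This is the
-- recursion from the back: either `y` stays last, or `x` goes behind it.
∑-insertions-∷ʳ : (f : List A → ℚ) (x : A) (ys : List A) (y : A) →
  ∑ f (insertions x (ys ∷ʳ y)) ≡ ∑ (λ zs → f (zs ∷ʳ y)) (insertions x ys) + f (ys ∷ʳ y ∷ʳ x)
∑-insertions-∷ʳ f x [] y = lemma (f (x ∷ y ∷ [])) (f (y ∷ x ∷ []))
  where
  lemma : ∀ a b → a + (b + 0ℚ) ≡ a + 0ℚ + b
  lemma = solve-∀ ℚ-ring
∑-insertions-∷ʳ f x (z ∷ ys) y = begin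
  f (x ∷ z ∷ ys ∷ʳ y) + ∑ f (map (z ∷_) (insertions x (ys ∷ʳ y)))
    ≡⟨ cong (f (x ∷ z ∷ ys ∷ʳ y) +_) (∑-map f (z ∷_) (insertions x (ys ∷ʳ y))) ⟩
  f (x ∷ z ∷ ys ∷ʳ y) + ∑ (f ∘ (z ∷_)) (insertions x (ys ∷ʳ y))
    ≡⟨ cong (f (x ∷ z ∷ ys ∷ʳ y) +_) (∑-insertions-∷ʳ (f ∘ (z ∷_)) x ys y) ⟩
  f (x ∷ z ∷ ys ∷ʳ y) + (∑ (λ zs → f (z ∷ zs ∷ʳ y)) (insertions x ys) + f (z ∷ ys ∷ʳ y ∷ʳ x))
    ≡⟨ +-assoc (f (x ∷ z ∷ ys ∷ʳ y)) _ _ ⟨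
  f (x ∷ z ∷ ys ∷ʳ y) + ∑ (λ zs → f (z ∷ zs ∷ʳ y)) (insertions x ys) + f (z ∷ ys ∷ʳ y ∷ʳ x)
    ≡⟨ cong (λ s → f (x ∷ z ∷ ys ∷ʳ y) + s + f (z ∷ ys ∷ʳ y ∷ʳ x))
            (∑-map (λ zs → f (zs ∷ʳ y)) (z ∷_) (insertions x ys)) ⟨
  f (x ∷ z ∷ ys ∷ʳ y) + ∑ (λ zs → f (zs ∷ʳ y)) (map (z ∷_) (insertions x ys)) + f (z ∷ ys ∷ʳ y ∷ʳ x) ∎
  where open ≡-Reasoning

∑-insertions-reverse : (f : List A → ℚ) (x : A) (ys : List A) →
  ∑ (f ∘ reverse) (insertions x ys) ≡ ∑ f (insertions x (reverse ys))
∑-insertions-reverse f x []       = refl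
∑-insertions-reverse f x (y ∷ ys) = begin
  f (reverse (x ∷ y ∷ ys)) + ∑ (f ∘ reverse) (map (y ∷_) (insertions x ys))
    ≡⟨ cong₂ _+_ (cong f (trans (unfold-reverse x (y ∷ ys)) (cong (_∷ʳ x) (unfold-reverse y ys))))
                 (trans (∑-map (f ∘ reverse) (y ∷_) (insertions x ys))
                        (∑-cong (insertions x ys) (λ zs → cong f (unfold-reverse y zs)))) ⟩
  f (reverse ys ∷ʳ y ∷ʳ x) + ∑ (λ zs → f (reverse zs ∷ʳ y)) (insertions x ys)
    ≡⟨ cong (f (reverse ys ∷ʳ y ∷ʳ x) +_) (∑-insertions-reverse (λ zs → f (zs ∷ʳ y)) x ys) ⟩
  f (reverse ys ∷ʳ y ∷ʳ x) + ∑ (λ zs → f (zs ∷ʳ y)) (insertions x (reverse ys))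
    ≡⟨ +-comm (f (reverse ys ∷ʳ y ∷ʳ x)) _ ⟩
  ∑ (λ zs → f (zs ∷ʳ y)) (insertions x (reverse ys)) + f (reverse ys ∷ʳ y ∷ʳ x)
    ≡⟨ ∑-insertions-∷ʳ f x (reverse ys) y ⟨
  ∑ f (insertions x (reverse ys ∷ʳ y))
    ≡⟨ cong (λ zs → ∑ f (insertions x zs)) (unfold-reverse y ys) ⟨
  ∑ f (insertions x (reverse (y ∷ ys))) ∎
  where open ≡-Reasoning

-- Reversal permutes the list of all orders. Stating this for sums of an arbitrary `f` lets the
-- induction apply to the function that sums `f` over the insertions of `x`.
∑-permutations-reverse : (f : List A → ℚ) (xs : List A) →
  ∑ (f ∘ reverse) (permutations xs) ≡ ∑ f (permutations xs)
∑-permutations-reverse f []       = refl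
∑-permutations-reverse f (x ∷ xs) = begin
  ∑ (f ∘ reverse) (concatMap (insertions x) (permutations xs))
    ≡⟨ ∑-concatMap (f ∘ reverse) (insertions x) (permutations xs) ⟩
  ∑ (λ ys → ∑ (f ∘ reverse) (insertions x ys)) (permutations xs)
    ≡⟨ ∑-cong (permutations xs) (∑-insertions-reverse f x) ⟩
  ∑ (λ ys → ∑ f (insertions x (reverse ys))) (permutations xs)
    ≡⟨ ∑-permutations-reverse (λ ys → ∑ f (insertions x ys)) xs ⟩
  ∑ (λ ys → ∑ f (insertions x ys)) (permutations xs)
    ≡⟨ ∑-concatMap f (insertions x) (permutations xs) ⟨
  ∑ f (concatMap (insertions x) (permutations xs)) ∎
  where open ≡-Reasoning

insertions-↭ : (x : A) (ys : List A) → All (_↭ x ∷ ys) (insertions x ys)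
insertions-↭ x []       = ↭-refl ∷ []
insertions-↭ x (y ∷ ys) =
  ↭-refl ∷ All.map⁺ (All.map (λ p → ↭-trans (prep y p) (swap y x ↭-refl)) (insertions-↭ x ys))

permutations-↭ : (xs : List A) → All (_↭ xs) (permutations xs)
permutations-↭ []       = ↭-refl ∷ []
permutations-↭ (x ∷ xs) = All.concat⁺ (All.map⁺
  (All.map (λ {ys} p → All.map (λ q → ↭-trans q (prep x p)) (insertions-↭ x ys)) (permutations-↭ xs)))

insertions-∷ : (x : A) (ys : List A) → ∃₂ λ z zss → insertions x ys ≡ z ∷ zss
insertions-∷ x []       = _ , _ , refl
insertions-∷ x (y ∷ ys) = _ , _ , refl

-- `mean` is 0 by convention on the empty list, so cancelling the number of orders requires that
-- there is at least one.
permutations-∷ : (xs : List A) → ∃₂ λ ys yss → permutations xs ≡ ys ∷ yss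
permutations-∷ []       = _ , _ , refl
permutations-∷ (x ∷ xs) with permutations xs | permutations-∷ xs
... | _ | ys , _ , refl with insertions x ys | insertions-∷ x ys
...   | _ | _ , _ , refl = _ , _ , refl

sumℚ-∑ : (xs : List ℚ) → sumℚ xs ≡ ∑ id xs
sumℚ-∑ []       = refl
sumℚ-∑ (x ∷ xs) = cong (x +_) (sumℚ-∑ xs)

toℚᵘ-count : (xs : List A) → toℚᵘ (count xs) ℚᵘ.≃ ℚᵘ.mkℚᵘ (ℤ.+ length xs) 0
toℚᵘ-count []       = ℚᵘ.≃-refl
toℚᵘ-count (x ∷ xs) = ℚᵘ.≃-trans (toℚᵘ-homo-+ 1ℚ (count xs))
  (ℚᵘ.≃-trans (ℚᵘ.+-congʳ (toℚᵘ 1ℚ) (toℚᵘ-count xs))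
    (ℚᵘ.≃-reflexive (cong (λ z → ℚᵘ.mkℚᵘ (ℤ.+ 1 ℤ.+ z) 0) (ℤ.*-identityʳ (ℤ.+ length xs)))))

-- The normalised fraction contains a gcd that does not compute for a variable length. In
-- unnormalised rationals the claim is a cross-multiplication of naturals.
count-inverse : (x : A) (xs : List A) → (ℤ.+ 1 / ℕ.suc (length xs)) * count (x ∷ xs) ≡ 1ℚ
count-inverse x xs = toℚᵘ-injective (ℚᵘ.≃-trans (toℚᵘ-homo-* (ℤ.+ 1 / ℕ.suc (length xs)) (count (x ∷ xs)))
  (ℚᵘ.≃-trans (ℚᵘ.*-cong (toℚᵘ-fromℚᵘ (ℚᵘ.mkℚᵘ (ℤ.+ 1) (length xs))) (toℚᵘ-count (x ∷ xs)))
    (ℚᵘ.*≡* (cong (λ m → ℤ.+ ℕ.suc m) (lemma (length xs))))))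
  where
  lemma : ∀ m → (m ℕ.+ 0) ℕ.* 1 ≡ m ℕ.* 1 ℕ.+ 0
  lemma m = trans (ℕ.*-identityʳ (m ℕ.+ 0)) (cong (ℕ._+ 0) (sym (ℕ.*-identityʳ m)))

mean-*-count : (x : ℚ) (xs : List ℚ) → mean (x ∷ xs) * count (x ∷ xs) ≡ ∑ id (x ∷ xs)
mean-*-count x xs = begin
  sumℚ (x ∷ xs) * (ℤ.+ 1 / ℕ.suc (length xs)) * count (x ∷ xs)
    ≡⟨ *-assoc (sumℚ (x ∷ xs)) (ℤ.+ 1 / ℕ.suc (length xs)) (count (x ∷ xs)) ⟩
  sumℚ (x ∷ xs) * ((ℤ.+ 1 / ℕ.suc (length xs)) * count (x ∷ xs))
    ≡⟨ cong₂ _*_ (sumℚ-∑ (x ∷ xs)) (count-inverse x xs) ⟩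
  ∑ id (x ∷ xs) * 1ℚ
    ≡⟨ *-identityʳ _ ⟩
  ∑ id (x ∷ xs) ∎
  where open ≡-Reasoning

mean-double : (c : ℚ) (x : ℚ) (xs : List ℚ) → ∑ id (x ∷ xs) + ∑ id (x ∷ xs) ≡ c * count (x ∷ xs) →
              mean (x ∷ xs) + mean (x ∷ xs) ≡ c
mean-double c x xs 2∑≡cn = begin
  m + m              ≡⟨ *-identityʳ (m + m) ⟨
  (m + m) * 1ℚ       ≡⟨ cong ((m + m) *_) (count-inverse x xs) ⟨
  (m + m) * (i * n)  ≡⟨ lemma m i n ⟩
  (m * n + m * n) * i ≡⟨ cong (λ a → (a + a) * i) (mean-*-count x xs) ⟩
  (∑ id (x ∷ xs) + ∑ id (x ∷ xs)) * i  ≡⟨ cong (_* i) 2∑≡cn ⟩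
  c * n * i          ≡⟨ lemma′ c n i ⟩
  c * (i * n)        ≡⟨ cong (c *_) (count-inverse x xs) ⟩
  c * 1ℚ             ≡⟨ *-identityʳ c ⟩
  c                  ∎
  where
  open ≡-Reasoning
  m = mean (x ∷ xs)
  n = count (x ∷ xs)
  i = ℤ.+ 1 / ℕ.suc (length xs)
  lemma : ∀ m i n → (m + m) * (i * n) ≡ (m * n + m * n) * i
  lemma = solve-∀ ℚ-ring
  lemma′ : ∀ c n i → c * n * i ≡ c * (i * n)
  lemma′ = solve-∀ ℚ-ring

-- Pairing each permutation with its reverse.
mean-permutations : (f : List A → ℚ) (c : ℚ) (xs : List A) →
  (∀ {ys} → ys ↭ xs → f ys + f (reverse ys) ≡ c) →
  mean (map f (permutations xs)) + mean (map f (permutations xs)) ≡ c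
mean-permutations f c xs f+f∘reverse≡c with permutations xs | permutations-∷ xs | double
  where
  open ≡-Reasoning
  all≡ : {yss : List (List _)} → All (_↭ xs) yss → ∑ (λ ys → f ys + f (reverse ys)) yss ≡ c * count yss
  all≡ []       = sym (*-zeroʳ c)
  all≡ {_ ∷ yss} (p ∷ ps) = trans (cong₂ _+_ (f+f∘reverse≡c p) (all≡ ps))
    (trans (cong (_+ c * count yss) (sym (*-identityʳ c))) (sym (*-distribˡ-+ c 1ℚ (count yss))))
  double : ∑ id (map f (permutations xs)) + ∑ id (map f (permutations xs)) ≡ c * count (map f (permutations xs))
  double = begin
    ∑ id (map f (permutations xs)) + ∑ id (map f (permutations xs))
      ≡⟨ cong₂ _+_ (∑-map id f (permutations xs)) (∑-map id f (permutations xs)) ⟩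
    ∑ f (permutations xs) + ∑ f (permutations xs)
      ≡⟨ cong (∑ f (permutations xs) +_) (∑-permutations-reverse f xs) ⟨
    ∑ f (permutations xs) + ∑ (f ∘ reverse) (permutations xs)
      ≡⟨ ∑-+ f (f ∘ reverse) (permutations xs) ⟨
    ∑ (λ ys → f ys + f (reverse ys)) (permutations xs)
      ≡⟨ all≡ (permutations-↭ xs) ⟩
    c * count (permutations xs)
      ≡⟨ cong (c *_) (∑-map (λ _ → 1ℚ) f (permutations xs)) ⟨
    c * count (map f (permutations xs)) ∎
... | _ | ys , yss , refl | double = mean-double c (f ys) (map f yss) double

-- The expected cost of Random

-- This models the test phase: a job executed right after its test has weight 1 and takes `1 + p`, a
-- deferred one has weight 0 and takes only its test.
weightedCompletion : (w d : A → ℚ) → ℚ → List A → ℚ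
weightedCompletion w d t []       = 0ℚ
weightedCompletion w d t (x ∷ xs) = w x * (t + d x) + weightedCompletion w d (t + d x) xs

weightedCompletion-∷ʳ : (w d : A → ℚ) (t : ℚ) (xs : List A) (x : A) →
  weightedCompletion w d t (xs ∷ʳ x) ≡ weightedCompletion w d t xs + w x * (t + ∑ d xs + d x)
weightedCompletion-∷ʳ w d t []       x = lemma (w x) t (d x)
  where
  lemma : ∀ w t d → w * (t + d) + 0ℚ ≡ 0ℚ + w * (t + 0ℚ + d)
  lemma = solve-∀ ℚ-ring
weightedCompletion-∷ʳ w d t (y ∷ ys) x =
  trans (cong (w y * (t + d y) +_) (weightedCompletion-∷ʳ w d (t + d y) ys x))
        (lemma (w y * (t + d y)) (weightedCompletion w d (t + d y) ys) (w x) t (d y) (∑ d ys) (d x))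
  where
  lemma : ∀ a b w t e s d → a + (b + w * (t + e + s + d)) ≡ a + b + w * (t + (e + s) + d)
  lemma = solve-∀ ℚ-ring

-- Every pair of elements occurs in both orders.
weightedCompletion-reverse : (w d : A → ℚ) (t t′ : ℚ) (xs : List A) →
  weightedCompletion w d t xs + weightedCompletion w d t′ (reverse xs)
    ≡ (t + t′) * ∑ w xs + ∑ w xs * ∑ d xs + ∑ (λ x → w x * d x) xs
weightedCompletion-reverse w d t t′ []       = lemma t t′
  where
  lemma : ∀ t t′ → 0ℚ + 0ℚ ≡ (t + t′) * 0ℚ + 0ℚ * 0ℚ + 0ℚ
  lemma = solve-∀ ℚ-ring
weightedCompletion-reverse w d t t′ (x ∷ xs) = begin
  w x * (t + d x) + W + weightedCompletion w d t′ (reverse (x ∷ xs))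
    ≡⟨ cong (λ ys → w x * (t + d x) + W + weightedCompletion w d t′ ys) (unfold-reverse x xs) ⟩
  w x * (t + d x) + W + weightedCompletion w d t′ (reverse xs ∷ʳ x)
    ≡⟨ cong (w x * (t + d x) + W +_) (weightedCompletion-∷ʳ w d t′ (reverse xs) x) ⟩
  w x * (t + d x) + W + (W′ + w x * (t′ + ∑ d (reverse xs) + d x))
    ≡⟨ cong (λ s → w x * (t + d x) + W + (W′ + w x * (t′ + s + d x))) (∑-↭ d (↭-reverse xs)) ⟩
  w x * (t + d x) + W + (W′ + w x * (t′ + ∑ d xs + d x))
    ≡⟨ split (w x) (d x) t t′ W W′ (∑ d xs) ⟩
  W + W′ + (w x * (t + t′ + ∑ d xs) + w x * d x + w x * d x)
    ≡⟨ cong (_+ (w x * (t + t′ + ∑ d xs) + w x * d x + w x * d x)) (weightedCompletion-reverse w d (t + d x) t′ xs) ⟩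
  (t + d x + t′) * ∑ w xs + ∑ w xs * ∑ d xs + ∑ (λ x → w x * d x) xs + (w x * (t + t′ + ∑ d xs) + w x * d x + w x * d x)
    ≡⟨ collect (w x) (d x) t t′ (∑ w xs) (∑ d xs) (∑ (λ x → w x * d x) xs) ⟩
  (t + t′) * (w x + ∑ w xs) + (w x + ∑ w xs) * (d x + ∑ d xs) + (w x * d x + ∑ (λ x → w x * d x) xs) ∎
  where
  open ≡-Reasoning
  W  = weightedCompletion w d (t + d x) xs
  W′ = weightedCompletion w d t′ (reverse xs)
  split : ∀ w d t t′ W W′ s → w * (t + d) + W + (W′ + w * (t′ + s + d)) ≡ W + W′ + (w * (t + t′ + s) + w * d + w * d)
  split = solve-∀ ℚ-ring
  collect : ∀ w d t t′ v s q → (t + d + t′) * v + v * s + q + (w * (t + t′ + s) + w * d + w * d)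
          ≡ (t + t′) * (w + v) + (w + v) * (d + s) + (w * d + q)
  collect = solve-∀ ℚ-ring

sumCBlocks-completions : (t : ℚ) (xs : List ℚ) (bs : List (ℚ × Bool)) →
  sumCBlocks t (map (λ x → (x , true)) xs ++ bs) ≡ completions t xs + sumCBlocks (t + ∑ id xs) bs
sumCBlocks-completions t []       bs =
  trans (cong (λ u → sumCBlocks u bs) (sym (+-identityʳ t))) (sym (+-identityˡ (sumCBlocks (t + 0ℚ) bs)))
sumCBlocks-completions t (x ∷ xs) bs = begin
  t + x + sumCBlocks (t + x) (map (λ x → (x , true)) xs ++ bs)
    ≡⟨ cong (t + x +_) (sumCBlocks-completions (t + x) xs bs) ⟩
  t + x + (completions (t + x) xs + sumCBlocks (t + x + ∑ id xs) bs)
    ≡⟨ +-assoc (t + x) (completions (t + x) xs) _ ⟨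
  t + x + completions (t + x) xs + sumCBlocks (t + x + ∑ id xs) bs
    ≡⟨ cong (λ u → t + x + completions (t + x) xs + sumCBlocks u bs) (+-assoc t x (∑ id xs)) ⟩
  t + x + completions (t + x) xs + sumCBlocks (t + (x + ∑ id xs)) bs ∎
  where open ≡-Reasoning

module _ {n : ℕ} (I : Instance n) (T E : ℚ) where
  open Instance I
  open Random I T E

  early : List (Fin n)
  early = filter (λ j → p j ≤? E) large

  private
    w d : Fin n → ℚ
    w j = if does (p j ≤? E) then 1ℚ else 0ℚ
    d j = 1ℚ + (if does (p j ≤? E) then p j else 0ℚ)

  sumCBlocks-phase2 : ∀ t σ bs →
    sumCBlocks t (concatMap phase2 σ ++ bs) ≡ weightedCompletion w d t σ + sumCBlocks (t + ∑ d σ) bs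
  sumCBlocks-phase2 t []      bs =
    trans (cong (λ u → sumCBlocks u bs) (sym (+-identityʳ t))) (sym (+-identityˡ (sumCBlocks (t + 0ℚ) bs)))
  sumCBlocks-phase2 t (j ∷ σ) bs with does (p j ≤? E)
  ... | true  = begin
    0ℚ + (t + 1ℚ + p j + S (t + 1ℚ + p j))
      ≡⟨ cong (λ u → 0ℚ + (u + S u)) (+-assoc t 1ℚ (p j)) ⟩
    0ℚ + (t + (1ℚ + p j) + S (t + (1ℚ + p j)))
      ≡⟨ cong (λ s → 0ℚ + (t + (1ℚ + p j) + s)) (sumCBlocks-phase2 (t + (1ℚ + p j)) σ bs) ⟩
    0ℚ + (t + (1ℚ + p j) + (W + sumCBlocks (t + (1ℚ + p j) + ∑ d σ) bs))
      ≡⟨ cong (λ u → 0ℚ + (t + (1ℚ + p j) + (W + sumCBlocks u bs))) (+-assoc t (1ℚ + p j) (∑ d σ)) ⟩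
    0ℚ + (t + (1ℚ + p j) + (W + sumCBlocks (t + (1ℚ + p j + ∑ d σ)) bs))
      ≡⟨ lemma (t + (1ℚ + p j)) W (sumCBlocks (t + (1ℚ + p j + ∑ d σ)) bs) ⟩
    1ℚ * (t + (1ℚ + p j)) + W + sumCBlocks (t + (1ℚ + p j + ∑ d σ)) bs ∎
    where
    open ≡-Reasoning
    S = λ u → sumCBlocks u (concatMap phase2 σ ++ bs)
    W = weightedCompletion w d (t + (1ℚ + p j)) σ
    lemma : ∀ a b c → 0ℚ + (a + (b + c)) ≡ 1ℚ * a + b + c
    lemma = solve-∀ ℚ-ring
  ... | false = begin
    0ℚ + S (t + 1ℚ)
      ≡⟨ cong (λ u → 0ℚ + S (t + u)) (+-identityʳ 1ℚ) ⟨
    0ℚ + S (t + (1ℚ + 0ℚ))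
      ≡⟨ cong (0ℚ +_) (sumCBlocks-phase2 (t + (1ℚ + 0ℚ)) σ bs) ⟩
    0ℚ + (W + sumCBlocks (t + (1ℚ + 0ℚ) + ∑ d σ) bs)
      ≡⟨ cong (λ u → 0ℚ + (W + sumCBlocks u bs)) (+-assoc t (1ℚ + 0ℚ) (∑ d σ)) ⟩
    0ℚ + (W + sumCBlocks (t + (1ℚ + 0ℚ + ∑ d σ)) bs)
      ≡⟨ lemma (t + (1ℚ + 0ℚ)) W (sumCBlocks (t + (1ℚ + 0ℚ + ∑ d σ)) bs) ⟩
    0ℚ * (t + (1ℚ + 0ℚ)) + W + sumCBlocks (t + (1ℚ + 0ℚ + ∑ d σ)) bs ∎
    where
    open ≡-Reasoning
    S = λ u → sumCBlocks u (concatMap phase2 σ ++ bs)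
    W = weightedCompletion w d (t + (1ℚ + 0ℚ)) σ
    lemma : ∀ a b c → 0ℚ + (b + c) ≡ 0ℚ * a + b + c
    lemma = solve-∀ ℚ-ring

  private
    smalls defs : List ℚ
    smalls = sort (map pbar small)
    defs = sort (map p deferred)

    t₀ : ℚ
    t₀ = ∑ id smalls

  costFor-split : ∀ σ → costFor σ ≡ completions 0ℚ smalls + (weightedCompletion w d t₀ σ + completions (t₀ + ∑ d σ) defs)
  costFor-split σ = begin
    costFor σ
      ≡⟨ sumCBlocks-completions 0ℚ smalls (concatMap phase2 σ ++ map (λ x → (x , true)) defs) ⟩
    completions 0ℚ smalls + sumCBlocks (0ℚ + t₀) (concatMap phase2 σ ++ map (λ x → (x , true)) defs)
      ≡⟨ cong (λ u → completions 0ℚ smalls + sumCBlocks u (concatMap phase2 σ ++ map (λ x → (x , true)) defs))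
              (+-identityˡ t₀) ⟩
    completions 0ℚ smalls + sumCBlocks t₀ (concatMap phase2 σ ++ map (λ x → (x , true)) defs)
      ≡⟨ cong (completions 0ℚ smalls +_) (sumCBlocks-phase2 t₀ σ (map (λ x → (x , true)) defs)) ⟩
    completions 0ℚ smalls + (weightedCompletion w d t₀ σ + completions (t₀ + ∑ d σ) defs) ∎
    where open ≡-Reasoning

  -- The end of the test phase does not depend on the order, so the first and last phases cost the
  -- same for `σ` and its reverse. In the middle phase all dependence on `σ` cancels, which is the
  -- hypothesis of `mean-permutations`.
  costFor-reverse : ∀ {σ} → σ ↭ large → costFor σ + costFor (reverse σ) ≡
    (completions 0ℚ smalls + completions 0ℚ smalls)
    + ((t₀ + t₀) * ∑ w large + ∑ w large * ∑ d large + ∑ (λ j → w j * d j) large)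
    + (completions (t₀ + ∑ d large) defs + completions (t₀ + ∑ d large) defs)
  costFor-reverse {σ} σ↭ = begin
    costFor σ + costFor (reverse σ)
      ≡⟨ cong₂ _+_ (costFor-split σ) (costFor-split (reverse σ)) ⟩
    c₁ + (W σ + completions (t₀ + ∑ d σ) defs) + (c₁ + (W (reverse σ) + completions (t₀ + ∑ d (reverse σ)) defs))
      ≡⟨ cong₂ (λ a b → c₁ + (W σ + completions (t₀ + a) defs) + (c₁ + (W (reverse σ) + completions (t₀ + b) defs)))
           (∑-↭ d σ↭) (∑-↭ d (↭-trans (↭-reverse σ) σ↭)) ⟩
    c₁ + (W σ + c₃) + (c₁ + (W (reverse σ) + c₃))
      ≡⟨ lemma c₁ (W σ) (W (reverse σ)) c₃ ⟩
    (c₁ + c₁) + (W σ + W (reverse σ)) + (c₃ + c₃)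
      ≡⟨ cong (λ a → (c₁ + c₁) + a + (c₃ + c₃)) (weightedCompletion-reverse w d t₀ t₀ σ) ⟩
    (c₁ + c₁) + ((t₀ + t₀) * ∑ w σ + ∑ w σ * ∑ d σ + ∑ (λ j → w j * d j) σ) + (c₃ + c₃)
      ≡⟨ cong (λ a → (c₁ + c₁) + a + (c₃ + c₃))
           (cong₂ _+_ (cong₂ (λ a b → (t₀ + t₀) * a + a * b) (∑-↭ w σ↭) (∑-↭ d σ↭)) (∑-↭ (λ j → w j * d j) σ↭)) ⟩
    (c₁ + c₁) + ((t₀ + t₀) * ∑ w large + ∑ w large * ∑ d large + ∑ (λ j → w j * d j) large) + (c₃ + c₃) ∎
    where
    open ≡-Reasoning
    W  = weightedCompletion w d t₀
    c₁ = completions 0ℚ smalls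
    c₃ = completions (t₀ + ∑ d large) defs
    lemma : ∀ a x y b → a + (x + b) + (a + (y + b)) ≡ (a + a) + (x + y) + (b + b)
    lemma = solve-∀ ℚ-ring

  private
    ∑w : ∑ w large ≡ count early
    ∑w = ∑-filter (λ j → p j ≤? E) (λ _ → 1ℚ) large

    ∑d : ∑ d large ≡ count large + ∑ p early
    ∑d = trans (∑-+ (λ _ → 1ℚ) (λ j → if does (p j ≤? E) then p j else 0ℚ) large)
               (cong (count large +_) (∑-filter (λ j → p j ≤? E) p large))

    ∑wd : ∑ (λ j → w j * d j) large ≡ ∑ (λ j → 1ℚ + p j) early
    ∑wd = trans (∑-cong large pointwise) (∑-filter (λ j → p j ≤? E) (λ j → 1ℚ + p j) large)
      where
      pointwise : ∀ j → w j * d j ≡ (if does (p j ≤? E) then 1ℚ + p j else 0ℚ)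
      pointwise j with does (p j ≤? E)
      ... | true  = *-identityˡ (1ℚ + p j)
      ... | false = *-zeroˡ (1ℚ + 0ℚ)

    ∑∑⊓-sort : (f : Fin n → ℚ) (js : List (Fin n)) → ∑∑⊓ (sort (map f js)) ≡ ∑∑ (λ i j → f i ⊓ f j) js js
    ∑∑⊓-sort f js = trans (∑∑-↭ _⊓_ (sort-↭ (map f js))) (∑∑⊓-map f js)

    ∑-sort : (f : Fin n → ℚ) (js : List (Fin n)) → ∑ id (sort (map f js)) ≡ ∑ f js
    ∑-sort f js = trans (∑-↭ id (sort-↭ (map f js))) (∑-map id f js)

    count-sort : (f : Fin n → ℚ) (js : List (Fin n)) → count (sort (map f js)) ≡ count js
    count-sort f js = trans (∑-↭ _ (sort-↭ (map f js))) (∑-map _ f js)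

    completions-sort : ∀ t (f : Fin n → ℚ) (js : List (Fin n)) →
      completions t (sort (map f js)) + completions t (sort (map f js))
      ≡ (t + t) * count js + ∑ f js + ∑∑ (λ i j → f i ⊓ f j) js js
    completions-sort t f js = trans (completions-sorted t (sort-AllPairs (map f js)))
      (cong₂ _+_ (cong₂ _+_ (cong ((t + t) *_) (count-sort f js)) (∑-sort f js)) (∑∑⊓-sort f js))

  -- `Λ` is the length of the test phase. After doubling, it is charged once per early job, since on
  -- average such a job waits for half of the other work of the phase, and twice per deferred job,
  -- which waits for all of it.
  twice-expected : let Λ = count large + ∑ p early; s = ∑ pbar small in
    expected + expected ≡
      ((0ℚ + 0ℚ) * count small + s + ∑∑ (λ i j → pbar i ⊓ pbar j) small small)
    + ((s + s) * count early + count early * Λ + ∑ (λ j → 1ℚ + p j) early)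
    + (((s + Λ) + (s + Λ)) * count deferred + ∑ p deferred + ∑∑ (λ i j → p i ⊓ p j) deferred deferred)
  twice-expected = trans (mean-permutations costFor _ large costFor-reverse)
    (cong₂ _+_
      (cong₂ _+_ (completions-sort 0ℚ pbar small)
        (cong₂ _+_ (cong₂ _+_ (cong₂ (λ s v → (s + s) * v) (∑-sort pbar small) ∑w) (cong₂ _*_ ∑w ∑d)) ∑wd))
      (trans (cong₂ (λ s Λ → completions (s + Λ) defs + completions (s + Λ) defs) (∑-sort pbar small) ∑d)
        (completions-sort (∑ pbar small + (count large + ∑ p early)) p deferred)))

-- Lower bound for arbitrary schedules

module _ {n : ℕ} where

  executed : List (Op n) → List (Fin n)
  executed []             = []
  executed (test j ∷ ops) = executed ops
  executed (exec j ∷ ops) = j ∷ executed ops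

  executed⁺ : ∀ {j} {ops : List (Op n)} → exec j ∈ ops → j ∈ executed ops
  executed⁺ {ops = exec _ ∷ _} (here refl) = here refl
  executed⁺ {ops = test _ ∷ _} (there e∈)  = executed⁺ e∈
  executed⁺ {ops = exec _ ∷ _} (there e∈)  = there (executed⁺ e∈)

  executed-All : ∀ {j} {ops : List (Op n)} → All (exec j ≢_) ops → All (j ≢_) (executed ops)
  executed-All []                             = []
  executed-All {ops = test _ ∷ _} (_ ∷ ≢s)  = executed-All ≢s
  executed-All {ops = exec _ ∷ _} (j≢ ∷ ≢s) = (λ { refl → j≢ refl }) ∷ executed-All ≢s

  executed-Unique : {ops : List (Op n)} → Unique ops → Unique (executed ops)
  executed-Unique []                             = []
  executed-Unique {ops = test _ ∷ _} (_ ∷ u)   = executed-Unique u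
  executed-Unique {ops = exec _ ∷ _} (∉ops ∷ u) = executed-All ∉ops ∷ executed-Unique u

  executed-↭ : {ops : List (Op n)} → Feasible ops → executed ops ↭ allFin n
  executed-↭ (unique , complete , _) = ∼bag⇒↭ (unique∧set⇒bag (executed-Unique unique) (allFin⁺ n)
    (mk⇔ (λ _ → ∈-allFin _) (λ _ → executed⁺ (complete _))))

  isTested : List (Fin n) → Fin n → ℚ
  isTested tested j = if does (j ∈Fin? tested) then 1ℚ else 0ℚ

  0≤isTested : ∀ tested j → 0ℚ ≤ isTested tested j
  0≤isTested tested j with does (j ∈Fin? tested)
  ... | true  = 0≤1
  ... | false = ≤-refl

  isTested≤1 : ∀ tested j → isTested tested j ≤ 1ℚ
  isTested≤1 tested j with does (j ∈Fin? tested)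
  ... | true  = ≤-refl
  ... | false = 0≤1

  isTested-≢ : ∀ {i j} tested → i ≢ j → isTested (i ∷ tested) j ≤ isTested tested j
  isTested-≢ {i} {j} tested i≢j with j Fin.≟ i
  ... | yes refl = contradiction refl i≢j
  ... | no _     = ≤-refl

  -- As `js` has no duplicates, at most one indicator changes. Equality can fail, because `i` may be
  -- absent from `js` or already tested.
  ∑-isTested-∷ : ∀ i tested {js} → Unique js → ∑ (isTested (i ∷ tested)) js ≤ ∑ (isTested tested) js + 1ℚ
  ∑-isTested-∷ i tested []            = ≤-trans 0≤1 (≤-reflexive (sym (+-identityˡ 1ℚ)))
  ∑-isTested-∷ i tested {j ∷ js} (j∉js ∷ u) with i Fin.≟ j
  ... | yes refl = begin
    isTested (i ∷ tested) i + ∑ (isTested (i ∷ tested)) js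
      ≤⟨ +-mono-≤ (isTested≤1 (i ∷ tested) i) (∑-mono (All.map (isTested-≢ tested) j∉js)) ⟩
    1ℚ + ∑ (isTested tested) js
      ≤⟨ x≤x+y (0≤isTested tested i) ⟩
    1ℚ + ∑ (isTested tested) js + isTested tested i
      ≡⟨ lemma (∑ (isTested tested) js) (isTested tested i) ⟩
    isTested tested i + ∑ (isTested tested) js + 1ℚ ∎
    where
    open ≤-Reasoning
    lemma : ∀ a b → 1ℚ + a + b ≡ b + a + 1ℚ
    lemma = solve-∀ ℚ-ring
  ... | no i≢j   = begin
    isTested (i ∷ tested) j + ∑ (isTested (i ∷ tested)) js
      ≤⟨ +-mono-≤ (isTested-≢ tested i≢j) (∑-isTested-∷ i tested u) ⟩
    isTested tested j + (∑ (isTested tested) js + 1ℚ)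
      ≡⟨ +-assoc (isTested tested j) _ 1ℚ ⟨
    isTested tested j + ∑ (isTested tested) js + 1ℚ ∎
    where open ≤-Reasoning

  module _ (I : Instance n) where
    open Instance I

    optTime : Fin n → ℚ
    optTime j = pbar j ⊓ (1ℚ + p j)

    duration : List (Fin n) → Fin n → ℚ
    duration tested j = if does (j ∈Fin? tested) then p j else pbar j

    optTime≤ : ∀ tested j → optTime j ≤ isTested tested j + duration tested j
    optTime≤ tested j with does (j ∈Fin? tested)
    ... | true  = p⊓q≤q (pbar j) (1ℚ + p j)
    ... | false = ≤-trans (p⊓q≤p (pbar j) (1ℚ + p j)) (≤-reflexive (sym (+-identityˡ (pbar j))))

    -- Tests of jobs that are still to be executed are charged to their execution: τ is the current
    -- time t without these tests.
    completions≤sumCOps : ∀ tested t τ ops → Unique (executed ops) →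
      τ + ∑ (isTested tested) (executed ops) ≤ t →
      completions τ (map optTime (executed ops)) ≤ sumCOps I tested t ops
    completions≤sumCOps tested t τ []             u          τ+≤t = ≤-refl
    completions≤sumCOps tested t τ (test j ∷ ops) u          τ+≤t =
      completions≤sumCOps (j ∷ tested) (t + 1ℚ) τ ops u (begin
        τ + ∑ (isTested (j ∷ tested)) js   ≤⟨ +-monoʳ-≤ τ (∑-isTested-∷ j tested u) ⟩
        τ + (∑ (isTested tested) js + 1ℚ)  ≡⟨ +-assoc τ _ 1ℚ ⟨
        τ + ∑ (isTested tested) js + 1ℚ    ≤⟨ +-monoˡ-≤ 1ℚ τ+≤t ⟩
        t + 1ℚ                             ∎)
      where
      open ≤-Reasoning
      js = executed ops
    completions≤sumCOps tested t τ (exec j ∷ ops) (j∉js ∷ u) τ+≤t =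
      +-mono-≤ (≤-trans (x≤x+y {τ + optTime j} (∑-nonneg (All.universal (0≤isTested tested) js))) τ′+≤t′)
               (completions≤sumCOps tested (t + duration tested j) (τ + optTime j) ops u τ′+≤t′)
      where
      open ≤-Reasoning
      js = executed ops
      lemma : ∀ τ a s d → τ + (a + d) + s ≡ τ + (a + s) + d
      lemma = solve-∀ ℚ-ring
      τ′+≤t′ : τ + optTime j + ∑ (isTested tested) js ≤ t + duration tested j
      τ′+≤t′ = begin
        τ + optTime j + ∑ (isTested tested) js
          ≤⟨ +-monoˡ-≤ _ (+-monoʳ-≤ τ (optTime≤ tested j)) ⟩
        τ + (isTested tested j + duration tested j) + ∑ (isTested tested) js
          ≡⟨ lemma τ (isTested tested j) (∑ (isTested tested) js) (duration tested j) ⟩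
        τ + (isTested tested j + ∑ (isTested tested) js) + duration tested j
          ≤⟨ +-monoˡ-≤ _ τ+≤t ⟩
        t + duration tested j ∎

    cost-lower : ∀ {ops} → Feasible ops →
      ∑ optTime (allFin n) + ∑∑ (λ i j → optTime i ⊓ optTime j) (allFin n) (allFin n) ≤ cost I ops + cost I ops
    cost-lower {ops} feasible = begin
      ∑ optTime (allFin n) + ∑∑ K (allFin n) (allFin n)
        ≡⟨ cong₂ _+_ (∑-↭ optTime (executed-↭ feasible)) (∑∑-↭ K (executed-↭ feasible)) ⟨
      ∑ optTime js + ∑∑ K js js
        ≡⟨ cong₂ _+_ (∑-map id optTime js) (∑∑⊓-map optTime js) ⟨
      ∑ id qs + ∑∑⊓ qs
        ≡⟨ lemma (count qs) (∑ id qs) (∑∑⊓ qs) ⟩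
      (0ℚ + 0ℚ) * count qs + ∑ id qs + ∑∑⊓ qs
        ≤⟨ completions-lower 0ℚ qs ⟩
      completions 0ℚ qs + completions 0ℚ qs
        ≤⟨ +-mono-≤ lower lower ⟩
      cost I ops + cost I ops ∎
      where
      open ≤-Reasoning
      K = λ i j → optTime i ⊓ optTime j
      js = executed ops
      qs = map optTime js
      none : ∀ js → ∑ (isTested []) js ≡ 0ℚ
      none js = trans (∑-const 0ℚ js) (*-zeroˡ (count js))
      lower = completions≤sumCOps [] 0ℚ 0ℚ ops (executed-Unique (proj₁ feasible))
        (≤-reflexive (trans (+-identityˡ _) (none js)))
      lemma : ∀ c s k → s + k ≡ (0ℚ + 0ℚ) * c + s + k
      lemma = solve-∀ ℚ-ring

-- The quadratic inequality

2ℚ 3ℚ 4ℚ : ℚ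
2ℚ = 1ℚ + 1ℚ
3ℚ = 2ℚ + 1ℚ
4ℚ = 2ℚ * 2ℚ

-- The quantities of the final inequality: N early jobs, B of them of size at least r, and D deferred
-- jobs; the early sizes lie in [1, r + w], and X and Y are their total excess in the
-- layers [1, r] and [r, r + w].  The levels g₂ and g₃ are free.
quadratic : (r w δ N B D X Y g₂ g₃ : ℚ) → ℚ
quadratic r w δ N B D X Y g₂ g₃ =
    r * (N * N + ((g₂ + g₂) * X - g₂ * g₂ * (r - 1ℚ)) + ((g₃ + g₃) * Y - g₃ * g₃ * w))
  + (r + r) * D * (N + X + Y) + δ * D * D
  - (N * (N + X + Y + B) + N * D + (D + D) * (N + X + Y + B))

-- 0≤gg, 0≤gD, 0≤DD and 0≤disc concern the coefficients that remain after completing squares.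
record Admissible (r w δ : ℚ) : Set where
  field
    1/2r    : ℚ
    0≤1/2r  : 0ℚ ≤ 1/2r
    inverse : (r + r) * 1/2r ≡ 1ℚ
    0≤r     : 0ℚ ≤ r
    0<r-1   : 0ℚ < r - 1ℚ
    0≤2-r   : 0ℚ ≤ 2ℚ - r
    0≤gg    : 0ℚ ≤ (r - 1ℚ) * (4ℚ * r * r * (r - 1ℚ) - w * r) - r * r * r
    0≤gD    : 0ℚ ≤ (r - 1ℚ) * (4ℚ * 2ℚ * r * (r - 1ℚ) * (r - 1ℚ) + 2ℚ * r * (2ℚ * r - 3ℚ)) - 2ℚ * r * r
    0≤DD    : 0ℚ ≤ (r - 1ℚ) * (4ℚ * (r - 1ℚ) * (r - 1ℚ) * (r - 1ℚ) + 2ℚ * (r - 1ℚ) * (2ℚ * r - 3ℚ) + δ) - r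
    0<c     : 0ℚ < 4ℚ * (r * r - r - 1ℚ)
    0≤disc  : 0ℚ ≤ 4ℚ * (r * r - r - 1ℚ) * δ - (2ℚ * r * r - 2ℚ * r - 3ℚ) * (2ℚ * r * r - 2ℚ * r - 3ℚ)
    0≤aD    : 0ℚ ≤ (r - 2ℚ) * (2ℚ * (r - 1ℚ)) + (2ℚ * r - 3ℚ)

module _ (r w δ : ℚ) (adm : Admissible r w δ) where
  open Admissible adm

  private
    0≤r-1 : 0ℚ ≤ r - 1ℚ
    0≤r-1 = <⇒≤ 0<r-1

    -- The minimiser of r g² - (N - 2 (r - 1) D) g, the integrand of the form in G t = g.
    level : ℚ → ℚ → ℚ
    level N D = (N - 2ℚ * (r - 1ℚ) * D) * 1/2r

    from-level : ℚ → ℚ → ℚ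
    from-level g D = (r + r) * g + 2ℚ * (r - 1ℚ) * D

    -- Expressing `N` through the level removes the division by `2r`, so the identities below are
    -- polynomial.
    from-level-level : ∀ N D → N ≡ from-level (level N D) D
    from-level-level N D = sym (trans (lemma r 1/2r N D)
      (trans (cong (λ u → u * (N - 2ℚ * (r - 1ℚ) * D) + 2ℚ * (r - 1ℚ) * D) inverse) (lemma′ r N D)))
      where
      lemma : ∀ r h N D → (r + r) * ((N - (1ℚ + 1ℚ) * (r - 1ℚ) * D) * h) + (1ℚ + 1ℚ) * (r - 1ℚ) * D
              ≡ ((r + r) * h) * (N - (1ℚ + 1ℚ) * (r - 1ℚ) * D) + (1ℚ + 1ℚ) * (r - 1ℚ) * D
      lemma = solve-∀ ℚ-ring
      lemma′ : ∀ r N D → 1ℚ * (N - (1ℚ + 1ℚ) * (r - 1ℚ) * D) + (1ℚ + 1ℚ) * (r - 1ℚ) * D ≡ N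
      lemma′ = solve-∀ ℚ-ring

    -- The value of `quadratic` at `N = from-level g D`, `X = (r - 1) B`, `g₂ = B` and `g₃ = g`,
    -- where `Y` drops out.
    profile : ℚ → ℚ → ℚ → ℚ
    profile g B D =
        r * (r - 1ℚ) * B * B - (r + r) * B * (r * g + D)
      + (4ℚ * r * r * (r - 1ℚ) - w * r) * g * g
      + (4ℚ * 2ℚ * r * (r - 1ℚ) * (r - 1ℚ) + 2ℚ * r * (2ℚ * r - 3ℚ)) * g * D
      + (4ℚ * (r - 1ℚ) * (r - 1ℚ) * (r - 1ℚ) + 2ℚ * (r - 1ℚ) * (2ℚ * r - 3ℚ) + δ) * D * D

    -- As a quadratic in `B` it is minimal at `B = (r g + D) / (r - 1)`. Multiplying by `r - 1`
    -- completes the square without division, and what remains is a form in `g` and `D` with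
    -- nonnegative coefficients.
    0≤profile : ∀ g B D → 0ℚ ≤ g → 0ℚ ≤ D → 0ℚ ≤ profile g B D
    0≤profile g B D 0≤g 0≤D = 0≤-cancelˡ (r - 1ℚ) 0<r-1 (0≤-resp
      (complete r g B D (4ℚ * r * r * (r - 1ℚ) - w * r)
        (4ℚ * 2ℚ * r * (r - 1ℚ) * (r - 1ℚ) + 2ℚ * r * (2ℚ * r - 3ℚ))
        (4ℚ * (r - 1ℚ) * (r - 1ℚ) * (r - 1ℚ) + 2ℚ * (r - 1ℚ) * (2ℚ * r - 3ℚ) + δ))
      (0≤+ (0≤+ (0≤+ (0≤* 0≤r (0≤square ((r - 1ℚ) * B - (r * g + D))))
                     (0≤* (0≤* 0≤gg 0≤g) 0≤g))
                (0≤* (0≤* 0≤gD 0≤g) 0≤D))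
           (0≤* (0≤* 0≤DD 0≤D) 0≤D)))
      where
      complete : ∀ r g B D a b c →
        (r - 1ℚ) * (r * (r - 1ℚ) * B * B - (r + r) * B * (r * g + D) + a * g * g + b * g * D + c * D * D)
        ≡ r * (((r - 1ℚ) * B - (r * g + D)) * ((r - 1ℚ) * B - (r * g + D)))
          + ((r - 1ℚ) * a - r * r * r) * g * g + ((r - 1ℚ) * b - (1ℚ + 1ℚ) * r * r) * g * D + ((r - 1ℚ) * c - r) * D * D
      complete = solve-∀ ℚ-ring

    -- With `g₃ = g` the coefficient of `Y` vanishes. The choice `g₂ = B` is exact when all early
    -- jobs below `r` have size 1: then `G` equals `B` throughout [1, r] and `X = (r - 1) B`. Any
    -- further excess `X` has the factor `B - g`.
    quadratic-B : ∀ r w δ g B D X Y →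
      let N = (r + r) * g + (1ℚ + 1ℚ) * (r - 1ℚ) * D
          2' = 1ℚ + 1ℚ ; 3' = 2' + 1ℚ ; 4' = 2' * 2'
      in
        r * (N * N + ((B + B) * X - B * B * (r - 1ℚ)) + ((g + g) * Y - g * g * w))
      + (r + r) * D * (N + X + Y) + δ * D * D
      - (N * (N + X + Y + B) + N * D + (D + D) * (N + X + Y + B))
      ≡ (r + r) * (B - g) * (X - (r - 1ℚ) * B)
        + ( r * (r - 1ℚ) * B * B - (r + r) * B * (r * g + D)
          + (4' * r * r * (r - 1ℚ) - w * r) * g * g
          + (4' * 2' * r * (r - 1ℚ) * (r - 1ℚ) + 2' * r * (2' * r - 3')) * g * D
          + (4' * (r - 1ℚ) * (r - 1ℚ) * (r - 1ℚ) + 2' * (r - 1ℚ) * (2' * r - 3') + δ) * D * D)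
    quadratic-B = solve-∀ ℚ-ring

    -- At the level g₂ = g₃ = g the coefficients of X and Y vanish, so B may be raised to g.
    quadratic-g : ∀ r w δ g B D X Y →
      let N = (r + r) * g + (1ℚ + 1ℚ) * (r - 1ℚ) * D
          2' = 1ℚ + 1ℚ ; 3' = 2' + 1ℚ ; 4' = 2' * 2'
      in
        r * (N * N + ((g + g) * X - g * g * (r - 1ℚ)) + ((g + g) * Y - g * g * w))
      + (r + r) * D * (N + X + Y) + δ * D * D
      - (N * (N + X + Y + B) + N * D + (D + D) * (N + X + Y + B))
      ≡ (N + D + D) * (g - B)
        + ( r * (r - 1ℚ) * g * g - (r + r) * g * (r * g + D)
          + (4' * r * r * (r - 1ℚ) - w * r) * g * g
          + (4' * 2' * r * (r - 1ℚ) * (r - 1ℚ) + 2' * r * (2' * r - 3')) * g * D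
          + (4' * (r - 1ℚ) * (r - 1ℚ) * (r - 1ℚ) + 2' * (r - 1ℚ) * (2' * r - 3') + δ) * D * D)
    quadratic-g = solve-∀ ℚ-ring

    -- With `g₃ = 0` the coefficient of `Y` is `m`. At `N = B`, `X = (r - 1) B`, `Y = 0`, that is,
    -- with every early job of size `r`, the form is `(r² - r - 1) B² + (2r² - 2r - 3) B D + δ D²`.
    -- The factor on the left completes its square in `B`, and `0≤disc` is its discriminant
    -- condition.
    quadratic-0 : ∀ r w δ N B D X Y →
      let 2' = 1ℚ + 1ℚ ; 3' = 2' + 1ℚ ; 4' = 2' * 2'
          m = 2' * (r - 1ℚ) * D - N
      in
        4' * (r * r - r - 1ℚ) * (r * (N * N + ((B + B) * X - B * B * (r - 1ℚ)) + ((0ℚ + 0ℚ) * Y - 0ℚ * 0ℚ * w))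
      + (r + r) * D * (N + X + Y) + δ * D * D
      - (N * (N + X + Y + B) + N * D + (D + D) * (N + X + Y + B)))
      ≡ 4' * (r * r - r - 1ℚ) *
        ( ((r + r) * B + m) * (X - (r - 1ℚ) * B) + m * Y
        + (r - 1ℚ) * ((N - B) * (N - B))
        + (N - B) * (((r - 2') * (2' * (r - 1ℚ)) + (2' * r - 3')) * D + (2' - r) * (m + (N - B))))
        + (2' * (r * r - r - 1ℚ) * B + (2' * r * r - 2' * r - 3') * D) * (2' * (r * r - r - 1ℚ) * B + (2' * r * r - 2' * r - 3') * D)
        + (4' * (r * r - r - 1ℚ) * δ - (2' * r * r - 2' * r - 3') * (2' * r * r - 2' * r - 3')) * D * D
    quadratic-0 = solve-∀ ℚ-ring

  -- The witnesses are `g₂ = max B level` and `g₃ = max 0 level`: the minimiser of the integrand,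
  -- raised to the least value that `G` can take, which is `B` on [1, r] and 0 above `r`. The three
  -- cases are the positions of the level relative to 0 and `B`.
  ∃-levels : ∀ {N B D X Y} → 0ℚ ≤ B → B ≤ N → 0ℚ ≤ D → (r - 1ℚ) * B ≤ X → 0ℚ ≤ Y →
             ∃₂ λ g₂ g₃ → 0ℚ ≤ quadratic r w δ N B D X Y g₂ g₃
  ∃-levels {N} {B} {D} {X} {Y} 0≤B B≤N 0≤D sB≤X 0≤Y
    with ≤-total (2ℚ * (r - 1ℚ) * D) N
  ... | inj₂ N≤kD = B , 0ℚ , 0≤-cancelˡ (4ℚ * (r * r - r - 1ℚ)) 0<c
        (0≤-resp (quadratic-0 r w δ N B D X Y)
          (0≤+ (0≤+ (0≤* (<⇒≤ 0<c)
            (0≤+ (0≤+ (0≤+ (0≤* (0≤+ (0≤* (0≤+ 0≤r 0≤r) 0≤B) 0≤m) 0≤X′)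
                           (0≤* 0≤m 0≤Y))
                      (0≤* 0≤r-1 (0≤square (N - B))))
                 (0≤* 0≤a (0≤+ (0≤* 0≤aD 0≤D) (0≤* 0≤2-r (0≤+ 0≤m 0≤a))))))
            (0≤square (2ℚ * (r * r - r - 1ℚ) * B + (2ℚ * r * r - 2ℚ * r - 3ℚ) * D)))
            (0≤* (0≤* 0≤disc 0≤D) 0≤D)))
    where
    0≤m  = x≤y⇒0≤y-x N≤kD
    0≤a  = x≤y⇒0≤y-x B≤N
    0≤X′ = x≤y⇒0≤y-x sB≤X
  ... | inj₁ kD≤N with ≤-total (level N D) B
  ...   | inj₁ g≤B = B , level N D ,
          subst (λ u → 0ℚ ≤ quadratic r w δ u B D X Y B (level N D)) (sym (from-level-level N D))
            (0≤-resp (quadratic-B r w δ (level N D) B D X Y)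
              (0≤+ (0≤* (0≤* (0≤+ 0≤r 0≤r) (x≤y⇒0≤y-x g≤B)) (x≤y⇒0≤y-x sB≤X))
                   (0≤profile (level N D) B D (0≤* (x≤y⇒0≤y-x kD≤N) 0≤1/2r) 0≤D)))
  ...   | inj₂ B≤g = level N D , level N D ,
          subst (λ u → 0ℚ ≤ quadratic r w δ u B D X Y (level N D) (level N D)) (sym (from-level-level N D))
            (0≤-resp (quadratic-g r w δ (level N D) B D X Y)
              (0≤+ (0≤* (0≤+ (0≤+ (subst (0ℚ ≤_) (from-level-level N D) (≤-trans 0≤B B≤N)) 0≤D) 0≤D) (x≤y⇒0≤y-x B≤g))
                   (0≤profile (level N D) (level N D) D (0≤* (x≤y⇒0≤y-x kD≤N) 0≤1/2r) 0≤D)))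

-- The competitive ratio

<⇒≱ : ∀ {x y} → x < y → ¬ (y ≤ x)
<⇒≱ x<y y≤x = <-irrefl refl (<-≤-trans x<y y≤x)

-- One number `r` is both the testing threshold and the ratio. A job with `p = 0` and upper limit
-- just below the threshold is executed untested where one test would do, so the ratio cannot be
-- below the threshold.
module Competitive (r E : ℚ) (adm : Admissible r (E - r) ((r - 1ℚ) * E - 2ℚ)) (r≤E : r ≤ E)
                   {n : ℕ} (I : Instance n) where
  open Admissible adm
  open Instance I
  open Random I r E

  q : Fin n → ℚ
  q = optTime I

  abstract
    short? : ∀ j → Dec (1ℚ + p j < r)
    short? j = 1ℚ + p j <? r

  -- A large early job is treated as one of size u j ≤ q j, whose test and execution take time at most
  -- u j + β j.
  u β : Fin n → ℚ
  u j = if does (short? j) then 1ℚ + p j else r ⊔ p j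
  β j = if does (short? j) then 0ℚ else 1ℚ

  1≤r : 1ℚ ≤ r
  1≤r = 0≤y-x⇒x≤y (<⇒≤ 0<r-1)

  x≤r*x : ∀ {x} → 0ℚ ≤ x → x ≤ r * x
  x≤r*x {x} 0≤x = 0≤y-x⇒x≤y (0≤-resp (lemma r x) (0≤* (<⇒≤ 0<r-1) 0≤x))
    where
    lemma : ∀ r x → r * x - x ≡ (r - 1ℚ) * x
    lemma = solve-∀ ℚ-ring

  r*-mono : ∀ {x y} → x ≤ y → r * x ≤ r * y
  r*-mono = *-monoˡ-≤-nonNeg r {{nonNegative 0≤r}}

  ≤r*⊓ : ∀ {x a b} → x ≤ r * a → x ≤ r * b → x ≤ r * (a ⊓ b)
  ≤r*⊓ {x} {a} {b} x≤ra x≤rb with ⊓-sel a b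
  ... | inj₁ a⊓b≡a = subst (λ c → x ≤ r * c) (sym a⊓b≡a) x≤ra
  ... | inj₂ a⊓b≡b = subst (λ c → x ≤ r * c) (sym a⊓b≡b) x≤rb

  1≤1+p : ∀ j → 1ℚ ≤ 1ℚ + p j
  1≤1+p j = x≤x+y (p≥0 j)

  0≤1+p : ∀ j → 0ℚ ≤ 1ℚ + p j
  0≤1+p j = ≤-trans 0≤1 (1≤1+p j)

  r≤r*[1+p] : ∀ j → r ≤ r * (1ℚ + p j)
  r≤r*[1+p] j = subst (_≤ r * (1ℚ + p j)) (*-identityʳ r) (r*-mono (1≤1+p j))

  0≤pbar : ∀ j → 0ℚ ≤ pbar j
  0≤pbar j = <⇒≤ (pbar>0 j)

  p≤q : ∀ j → p j ≤ q j
  p≤q j = ⊓-glb (p≤pbar j) (≤-trans (≤-reflexive (sym (+-identityˡ (p j)))) (+-monoˡ-≤ (p j) 0≤1))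

  p≤r*q : ∀ j → p j ≤ r * q j
  p≤r*q j = ≤-trans (x≤r*x (p≥0 j)) (r*-mono (p≤q j))

  small⇒pbar≤r*q : ∀ {j} → pbar j < r → pbar j ≤ r * q j
  small⇒pbar≤r*q {j} pbar<r = ≤r*⊓ (x≤r*x (0≤pbar j)) (≤-trans (<⇒≤ pbar<r) (r≤r*[1+p] j))

  small-large : ∀ {i j} → pbar i < r → r ≤ pbar j → pbar i ≤ r * (q i ⊓ q j)
  small-large {i} {j} pbar<r r≤pbar = ≤r*⊓ (small⇒pbar≤r*q pbar<r)
    (≤r*⊓ (≤-trans (<⇒≤ pbar<r) (≤-trans r≤pbar (x≤r*x (0≤pbar j)))) (≤-trans (<⇒≤ pbar<r) (r≤r*[1+p] j)))

  -- The critical job has `p = pbar = r`, where the test is wasted and the claim reads `1 + r ≤ r²`;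
  -- thus `r` has to be at least the golden ratio.
  large⇒1+p≤r*q : ∀ {j} → r ≤ pbar j → 1ℚ + p j ≤ r * q j
  large⇒1+p≤r*q {j} r≤pbar = ≤r*⊓ (≤-trans (+-monoʳ-≤ 1ℚ (p≤pbar j)) 1+pbar≤) (x≤r*x (0≤1+p j))
    where
    0≤c : 0ℚ ≤ r * r - r - 1ℚ
    0≤c = 0≤-cancelˡ 4ℚ (toWitness {a? = 0ℚ <? 4ℚ} _) (<⇒≤ 0<c)
    lemma : ∀ r b → r * b - (1ℚ + b) ≡ (r - 1ℚ) * (b - r) + (r * r - r - 1ℚ)
    lemma = solve-∀ ℚ-ring
    1+pbar≤ : 1ℚ + pbar j ≤ r * pbar j
    1+pbar≤ = 0≤y-x⇒x≤y (0≤-resp (lemma r (pbar j)) (0≤+ (0≤* (<⇒≤ 0<r-1) (x≤y⇒0≤y-x r≤pbar)) 0≤c))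

  1≤u : ∀ j → 1ℚ ≤ u j
  1≤u j with does (short? j)
  ... | true  = 1≤1+p j
  ... | false = ≤-trans 1≤r (p≤p⊔q r (p j))

  u≤E : ∀ {j} → p j ≤ E → u j ≤ E
  u≤E {j} p≤E with short? j
  ... | yes 1+p<r = ≤-trans (<⇒≤ 1+p<r) r≤E
  ... | no _      = ⊔-lub r≤E p≤E

  -- For a given `p j`, `u j` is the least value that `q j` takes as `pbar j` varies above `r` and
  -- `p j`. Passing to it eliminates the upper limits of the early jobs.
  u≤q : ∀ {j} → r ≤ pbar j → u j ≤ q j
  u≤q {j} r≤pbar with short? j
  ... | yes 1+p<r = ⊓-glb (≤-trans (<⇒≤ 1+p<r) r≤pbar) ≤-refl
  ... | no 1+p≮r  = ⊓-glb (⊔-lub r≤pbar (p≤pbar j))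
                          (⊔-lub (≮⇒≥ 1+p≮r) (≤-trans (≤-reflexive (sym (+-identityˡ (p j)))) (+-monoˡ-≤ (p j) 0≤1)))

  1+p≤u+β : ∀ j → 1ℚ + p j ≤ u j + β j
  1+p≤u+β j with does (short? j)
  ... | true  = ≤-reflexive (sym (+-identityʳ (1ℚ + p j)))
  ... | false = ≤-trans (≤-reflexive (+-comm 1ℚ (p j))) (+-monoˡ-≤ 1ℚ (p≤q⊔p r (p j)))

  0≤β : ∀ j → 0ℚ ≤ β j
  0≤β j with does (short? j)
  ... | true  = ≤-refl
  ... | false = 0≤1

  β≤1 : ∀ j → β j ≤ 1ℚ
  β≤1 j with does (short? j)
  ... | true  = 0≤1
  ... | false = ≤-refl

  [r-1]β≤ : ∀ j → (r - 1ℚ) * β j ≤ u j ⊓ r - 1ℚ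
  [r-1]β≤ j with does (short? j)
  ... | true  = ≤-trans (≤-reflexive (*-zeroʳ (r - 1ℚ))) (x≤y⇒0≤y-x (⊓-glb (1≤1+p j) 1≤r))
  ... | false = ≤-trans (≤-reflexive (*-identityʳ (r - 1ℚ))) (+-monoˡ-≤ (- 1ℚ) (⊓-glb (p≤p⊔q r (p j)) ≤-refl))

  -- Each ordered pair of deferred jobs carries two units of testing in the doubled cost, because
  -- every deferred job waits for all tests. The remaining slack `(r - 1) E - 2` is the `δ` that
  -- helps to pay for the early jobs.
  deferred-deferred : ∀ {i j} → E ≤ p i → E ≤ p j → p i ⊓ p j + (2ℚ + ((r - 1ℚ) * E - 2ℚ)) ≤ r * (q i ⊓ q j)
  deferred-deferred {i} {j} E≤pi E≤pj = ≤-trans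
    (0≤y-x⇒x≤y (0≤-resp (lemma r E (p i ⊓ p j)) (0≤* (<⇒≤ 0<r-1) (x≤y⇒0≤y-x (⊓-glb E≤pi E≤pj)))))
    (r*-mono (⊓-mono-≤ (p≤q i) (p≤q j)))
    where
    lemma : ∀ r E m → r * m - (m + ((1ℚ + 1ℚ) + ((r - 1ℚ) * E - (1ℚ + 1ℚ)))) ≡ (r - 1ℚ) * (m - E)
    lemma = solve-∀ ℚ-ring

  tested : List (Fin n)
  tested = early I r E ++ deferred

  large-↭ : large ↭ tested
  large-↭ = filter-++-↭ (λ j → p j ≤? E) (λ j → E <? p j) (λ _ p≤E E<p → <⇒≱ E<p p≤E) (λ _ → ≰⇒>) large

  allFin-↭ : allFin n ↭ small ++ tested
  allFin-↭ = ↭-trans (filter-++-↭ (λ j → pbar j <? r) (λ j → r ≤? pbar j) (λ _ → <⇒≱) (λ _ → ≮⇒≥) (allFin n))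
                     (++⁺ˡ small large-↭)

  small-All : All (λ j → pbar j < r) small
  small-All = All.all-filter (λ j → pbar j <? r) (allFin n)

  large-All : All (λ j → r ≤ pbar j) large
  large-All = All.all-filter (λ j → r ≤? pbar j) (allFin n)

  early-All : All (λ j → r ≤ pbar j × p j ≤ E) (early I r E)
  early-All = All.zip (All.filter⁺ (λ j → p j ≤? E) large-All , All.all-filter (λ j → p j ≤? E) large)

  deferred-All : All (λ j → E ≤ p j) deferred
  deferred-All = All.map <⇒≤ (All.all-filter (λ j → E <? p j) large)

  tested-All : All (λ j → r ≤ pbar j) tested
  tested-All = All.++⁺ (All.map proj₁ early-All) (All.filter⁺ (λ j → E <? p j) large-All)

  pairs : {K L : Fin n → Fin n → ℚ} {P Q : Fin n → Set} {xs ys : List (Fin n)} →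
          (∀ {i j} → P i → Q j → K i j ≤ L i j) → All P xs → All Q ys → ∑∑ K xs ys ≤ ∑∑ L xs ys
  pairs K≤L Pxs Qys = ∑∑-mono (All.map (λ Pi → All.map (K≤L Pi) Qys) Pxs)

  K : Fin n → Fin n → ℚ
  K i j = q i ⊓ q j

  private
    S = small
    F = early I r E
    D = deferred
    N  = count F
    Nᴰ = count D
    U = ∑ u F
    H = ∑ β F
    X = ∑ (λ j → u j ⊓ r - 1ℚ) F
    Y = ∑ (λ j → u j - u j ⊓ r) F
    δ = (r - 1ℚ) * E - 2ℚ

  ∑r* : {f g : Fin n → ℚ} {xs : List (Fin n)} → All (λ j → f j ≤ r * g j) xs → ∑ f xs ≤ r * ∑ g xs
  ∑r* {g = g} {xs} f≤rg = ≤-trans (∑-mono f≤rg) (≤-reflexive (∑-*ˡ r g xs))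

  ∑∑r* : {L : Fin n → Fin n → ℚ} {P Q : Fin n → Set} {xs ys : List (Fin n)} →
         (∀ {i j} → P i → Q j → L i j ≤ r * K i j) → All P xs → All Q ys → ∑∑ L xs ys ≤ r * ∑∑ K xs ys
  ∑∑r* {xs = xs} {ys} L≤rK Pxs Qys = ≤-trans (pairs L≤rK Pxs Qys) (≤-reflexive (∑∑-*ˡ r K xs ys))

  small-small-bound : ∑∑ (λ i j → pbar i ⊓ pbar j) S S ≤ r * ∑∑ K S S
  small-small-bound = ∑∑r* (λ {i} {j} i<r j<r → ≤r*⊓
    (≤-trans (p⊓q≤p (pbar i) (pbar j)) (small⇒pbar≤r*q i<r))
    (≤-trans (p⊓q≤q (pbar i) (pbar j)) (small⇒pbar≤r*q j<r))) small-All small-All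

  small-large-bound : count tested * ∑ pbar S ≤ r * ∑∑ K S tested
  small-large-bound = ≤-trans (≤-reflexive (sym (∑∑-constʳ pbar S tested))) (∑∑r* small-large small-All tested-All)

  early-deferred-bound : Nᴰ * ∑ u F ≤ ∑∑ K F D
  early-deferred-bound = ≤-trans (≤-reflexive (sym (∑∑-constʳ u F D)))
    (pairs (λ {i} {j} (r≤pbar , pi≤E) E≤pj →
        ⊓-glb (u≤q r≤pbar) (≤-trans (u≤E pi≤E) (≤-trans E≤pj (p≤q j))))
      early-All deferred-All)

  deferred-deferred-bound : ∑∑ (λ i j → p i ⊓ p j) D D + (2ℚ + ((r - 1ℚ) * E - 2ℚ)) * (Nᴰ * Nᴰ) ≤ r * ∑∑ K D D
  deferred-deferred-bound = ≤-trans (≤-reflexive (sym (trans (∑∑-+ (λ i j → p i ⊓ p j) (λ _ _ → c) D D)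
      (cong (∑∑ (λ i j → p i ⊓ p j) D D +_)
        (trans (∑∑-constʳ (λ _ → c) D D) (trans (cong (Nᴰ *_) (∑-const c D)) (lemma Nᴰ c)))))))
    (∑∑r* deferred-deferred deferred-All deferred-All)
    where
    c = 2ℚ + ((r - 1ℚ) * E - 2ℚ)
    lemma : ∀ n c → n * (c * n) ≡ c * (n * n)
    lemma = solve-∀ ℚ-ring

  U≡N+X+Y : U ≡ N + X + Y
  U≡N+X+Y = begin
    ∑ u F                                                     ≡⟨ ∑-cong F (λ j → lemma (u j) (u j ⊓ r)) ⟩
    ∑ (λ j → 1ℚ + (u j ⊓ r - 1ℚ) + (u j - u j ⊓ r)) F         ≡⟨ ∑-+ _ _ F ⟩
    ∑ (λ j → 1ℚ + (u j ⊓ r - 1ℚ)) F + Y                       ≡⟨ cong (_+ Y) (∑-+ _ _ F) ⟩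
    N + X + Y                                                 ∎
    where
    open ≡-Reasoning
    lemma : ∀ u m → u ≡ 1ℚ + (m - 1ℚ) + (u - m)
    lemma = solve-∀ ℚ-ring

  -- The left side collects everything that involves early jobs: their own work delaying each other,
  -- tests of deferred jobs delaying them, and their work delaying deferred jobs. It is paid for
  -- jointly by the early pairs, the mixed pairs and the slack `δ` of the deferred pairs.
  early-early-bound : N * (U + H) + N * Nᴰ + (Nᴰ + Nᴰ) * (U + H) ≤ r * ∑∑ K F F + (r + r) * Nᴰ * U + δ * Nᴰ * Nᴰ
  early-early-bound
    with g₂ , g₃ , 0≤quadratic ← ∃-levels r (E - r) δ adm {N} {H} {Nᴰ} {X} {Y}
           (∑-nonneg (All.universal 0≤β F)) (∑-mono (All.universal β≤1 F)) (0≤count D)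
           (≤-trans (≤-reflexive (sym (∑-*ˡ (r - 1ℚ) β F))) (∑-mono (All.universal [r-1]β≤ F)))
           (∑-nonneg (All.universal (λ j → x≤y⇒0≤y-x (p⊓q≤p (u j) r)) F)) = begin
    N * (U + H) + N * Nᴰ + (Nᴰ + Nᴰ) * (U + H)
      ≡⟨ cong (λ a → N * (a + H) + N * Nᴰ + (Nᴰ + Nᴰ) * (a + H)) U≡N+X+Y ⟩
    N * (N + X + Y + H) + N * Nᴰ + (Nᴰ + Nᴰ) * (N + X + Y + H)
      ≤⟨ 0≤y-x⇒x≤y 0≤quadratic ⟩
    r * levels + (r + r) * Nᴰ * (N + X + Y) + δ * Nᴰ * Nᴰ
      ≡⟨ cong (λ a → r * levels + (r + r) * Nᴰ * a + δ * Nᴰ * Nᴰ) U≡N+X+Y ⟨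
    r * levels + (r + r) * Nᴰ * U + δ * Nᴰ * Nᴰ
      ≤⟨ +-monoˡ-≤ (δ * Nᴰ * Nᴰ) (+-monoˡ-≤ ((r + r) * Nᴰ * U) (r*-mono (≤-trans
           (∑∑⊓-layers u 1≤r r≤E (All.universal 1≤u F) (All.map (u≤E ∘ proj₂) early-All) g₂ g₃)
           (pairs (λ (r≤i , _) (r≤j , _) → ⊓-mono-≤ (u≤q r≤i) (u≤q r≤j)) early-All early-All)))) ⟩
    r * ∑∑ K F F + (r + r) * Nᴰ * U + δ * Nᴰ * Nᴰ ∎
    where
    open ≤-Reasoning
    levels = N * N + ((g₂ + g₂) * X - g₂ * g₂ * (r - 1ℚ)) + ((g₃ + g₃) * Y - g₃ * g₃ * (E - r))

  e≤U+H : ∑ (λ j → 1ℚ + p j) F ≤ U + H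
  e≤U+H = ≤-trans (∑-mono (All.universal 1+p≤u+β F)) (≤-reflexive (∑-+ u β F))

  large-cost : let P = ∑ p F; Λ = count large + P in
    N * Λ + (Λ + Λ) * Nᴰ + ∑∑ (λ i j → p i ⊓ p j) D D ≤ r * (∑∑ K F F + (∑∑ K F D + ∑∑ K F D) + ∑∑ K D D)
  large-cost = begin
    N * Λ + (Λ + Λ) * Nᴰ + QQ
      ≡⟨ cong (λ a → N * a + (a + a) * Nᴰ + QQ) Λ≡Nᴰ+e ⟩
    N * (Nᴰ + e) + ((Nᴰ + e) + (Nᴰ + e)) * Nᴰ + QQ
      ≡⟨ split N Nᴰ e QQ ⟩
    (N + Nᴰ + Nᴰ) * e + (N * Nᴰ + (Nᴰ + Nᴰ) * Nᴰ + QQ)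
      ≤⟨ +-monoˡ-≤ _ (*-monoˡ-≤-nonNeg (N + Nᴰ + Nᴰ)
           {{nonNegative (0≤+ (0≤+ (0≤count F) (0≤count D)) (0≤count D))}} e≤U+H) ⟩
    (N + Nᴰ + Nᴰ) * (U + H) + (N * Nᴰ + (Nᴰ + Nᴰ) * Nᴰ + QQ)
      -- `δ * Nᴰ * Nᴰ` is added and subtracted: the deferred pairs lend it to the early jobs.
      ≡⟨ regroup N Nᴰ (U + H) QQ δ ⟩
    (N * (U + H) + N * Nᴰ + (Nᴰ + Nᴰ) * (U + H)) + (QQ + (2ℚ + δ) * (Nᴰ * Nᴰ)) - δ * Nᴰ * Nᴰ
      ≤⟨ +-monoˡ-≤ (- (δ * Nᴰ * Nᴰ)) (+-mono-≤ early-early-bound deferred-deferred-bound) ⟩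
    (r * ∑∑ K F F + (r + r) * Nᴰ * U + δ * Nᴰ * Nᴰ) + r * ∑∑ K D D - δ * Nᴰ * Nᴰ
      ≡⟨ simplify r (∑∑ K F F) Nᴰ U (δ * Nᴰ * Nᴰ) (∑∑ K D D) ⟩
    r * (∑∑ K F F + (Nᴰ * U + Nᴰ * U) + ∑∑ K D D)
      ≤⟨ r*-mono (+-monoˡ-≤ _ (+-monoʳ-≤ (∑∑ K F F) (+-mono-≤ early-deferred-bound early-deferred-bound))) ⟩
    r * (∑∑ K F F + (∑∑ K F D + ∑∑ K F D) + ∑∑ K D D) ∎
    where
    open ≤-Reasoning
    P = ∑ p F
    Λ = count large + P
    e = ∑ (λ j → 1ℚ + p j) F
    QQ = ∑∑ (λ i j → p i ⊓ p j) D D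
    reorder : ∀ a b c → a + b + c ≡ b + (a + c)
    reorder = solve-∀ ℚ-ring
    Λ≡Nᴰ+e : Λ ≡ Nᴰ + e
    Λ≡Nᴰ+e = trans (cong (_+ P) (trans (∑-↭ _ large-↭) (∑-++ _ F D)))
      (trans (reorder N Nᴰ P) (cong (Nᴰ +_) (sym (∑-+ (λ _ → 1ℚ) p F))))
    split : ∀ n d e q → n * (d + e) + ((d + e) + (d + e)) * d + q ≡ (n + d + d) * e + (n * d + (d + d) * d + q)
    split = solve-∀ ℚ-ring
    regroup : ∀ n d v q δ → (n + d + d) * v + (n * d + (d + d) * d + q)
            ≡ (n * v + n * d + (d + d) * v) + (q + ((1ℚ + 1ℚ) + δ) * (d * d)) - δ * d * d
    regroup = solve-∀ ℚ-ring
    simplify : ∀ r f d u δdd k → (r * f + (r + r) * d * u + δdd) + r * k - δdd ≡ r * (f + (d * u + d * u) + k)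
    simplify = solve-∀ ℚ-ring

  opt-split : ∑ q S + (∑ q F + ∑ q D)
            + (∑∑ K S S + (∑∑ K S tested + ∑∑ K S tested) + (∑∑ K F F + (∑∑ K F D + ∑∑ K F D) + ∑∑ K D D))
            ≡ ∑ q (allFin n) + ∑∑ K (allFin n) (allFin n)
  opt-split = sym (cong₂ _+_
    (trans (∑-↭ q allFin-↭) (trans (∑-++ q S tested) (cong (∑ q S +_) (∑-++ q F D))))
    (trans (∑∑-↭ K allFin-↭) (trans (∑∑-++ K-comm S tested)
      (cong (∑∑ K S S + (∑∑ K S tested + ∑∑ K S tested) +_) (∑∑-++ K-comm F D)))))
    where
    K-comm : ∀ i j → K i j ≡ K j i
    K-comm i j = ⊓-comm (q i) (q j)

  competitive : ∀ {ops} → Feasible ops → expected ≤ r * cost I ops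
  competitive {ops} feasible = halve (begin
    expected + expected
      ≡⟨ twice-expected I r E ⟩
    ((0ℚ + 0ℚ) * count S + s + SS) + ((s + s) * N + N * Λ + e) + (((s + Λ) + (s + Λ)) * Nᴰ + ∑ p D + QQ)
      ≡⟨ split (count S) s SS N Λ e Nᴰ (∑ p D) QQ ⟩
    s + (e + ∑ p D) + (SS + ((N + Nᴰ) * s + (N + Nᴰ) * s) + (N * Λ + (Λ + Λ) * Nᴰ + QQ))
      ≡⟨ cong (λ a → s + (e + ∑ p D) + (SS + (a * s + a * s) + (N * Λ + (Λ + Λ) * Nᴰ + QQ))) (∑-++ _ F D) ⟨
    s + (e + ∑ p D) + (SS + (count tested * s + count tested * s) + (N * Λ + (Λ + Λ) * Nᴰ + QQ))
      ≤⟨ +-mono-≤ (+-mono-≤ (∑r* (All.map small⇒pbar≤r*q small-All))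
                            (+-mono-≤ (∑r* (All.map (large⇒1+p≤r*q ∘ proj₁) early-All)) (∑r* (All.universal p≤r*q D))))
                  (+-mono-≤ (+-mono-≤ small-small-bound (+-mono-≤ small-large-bound small-large-bound)) large-cost) ⟩
    r * ∑ q S + (r * ∑ q F + r * ∑ q D) + (r * ∑∑ K S S + (r * ∑∑ K S tested + r * ∑∑ K S tested) + r * KL)
      ≡⟨ factor r (∑ q S) (∑ q F) (∑ q D) (∑∑ K S S) (∑∑ K S tested) KL ⟩
    r * (∑ q S + (∑ q F + ∑ q D) + (∑∑ K S S + (∑∑ K S tested + ∑∑ K S tested) + KL))
      ≡⟨ cong (r *_) opt-split ⟩
    r * (∑ q (allFin n) + ∑∑ K (allFin n) (allFin n))
      ≤⟨ r*-mono (cost-lower I feasible) ⟩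
    r * (cost I ops + cost I ops)
      ≡⟨ *-distribˡ-+ r (cost I ops) (cost I ops) ⟩
    r * cost I ops + r * cost I ops ∎)
    where
    open ≤-Reasoning
    s  = ∑ pbar S
    SS = ∑∑ (λ i j → pbar i ⊓ pbar j) S S
    QQ = ∑∑ (λ i j → p i ⊓ p j) D D
    e  = ∑ (λ j → 1ℚ + p j) F
    Λ  = count large + ∑ p F
    KL = ∑∑ K F F + (∑∑ K F D + ∑∑ K F D) + ∑∑ K D D
    split : ∀ c s ss n Λ e d pd qq →
      ((0ℚ + 0ℚ) * c + s + ss) + ((s + s) * n + n * Λ + e) + (((s + Λ) + (s + Λ)) * d + pd + qq)
      ≡ s + (e + pd) + (ss + ((n + d) * s + (n + d) * s) + (n * Λ + (Λ + Λ) * d + qq))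
    split = solve-∀ ℚ-ring
    factor : ∀ r a b c d e f → r * a + (r * b + r * c) + (r * d + (r * e + r * e) + r * f) ≡ r * (a + (b + c) + (d + (e + e) + f))
    factor = solve-∀ ℚ-ring
    halve : ∀ {x y} → x + x ≤ y + y → x ≤ y
    halve {x} {y} 2x≤2y = 0≤y-x⇒x≤y
      (0≤-cancelˡ 2ℚ (toWitness {a? = 0ℚ <? 2ℚ} _) (0≤-resp (lemma x y) (x≤y⇒0≤y-x 2x≤2y)))
      where
      lemma : ∀ x y → (1ℚ + 1ℚ) * (y - x) ≡ y + y - (x + x)
      lemma = solve-∀ ℚ-ring

-- The two critical conditions are `0≤gg`, which governs inputs without deferred jobs, and `0≤disc`,
-- which governs early jobs of size `r` next to deferred ones. A larger `Eparam` hurts the former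
-- through `w` and helps the latter through `δ`. Both hold here with less than 0.001 to spare, and
-- for this ratio they leave an interval shorter than 0.001 for `Eparam`.
admissible : Admissible Tparam (Eparam - Tparam) ((Tparam - 1ℚ) * Eparam - 2ℚ)
admissible = record
  { 1/2r    = ℤ.+ 5000 / 17453
  ; 0≤1/2r  = toWitness {a? = _ ≤? _} _
  ; inverse = refl
  ; 0≤r     = toWitness {a? = _ ≤? _} _
  ; 0<r-1   = toWitness {a? = _ <? _} _
  ; 0≤2-r   = toWitness {a? = _ ≤? _} _
  ; 0≤gg    = toWitness {a? = _ ≤? _} _
  ; 0≤gD    = toWitness {a? = _ ≤? _} _
  ; 0≤DD    = toWitness {a? = _ ≤? _} _
  ; 0<c     = toWitness {a? = _ <? _} _
  ; 0≤disc  = toWitness {a? = _ ≤? _} _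
  ; 0≤aD    = toWitness {a? = _ ≤? _} _
  }

theorem3 : ∀ (n : ℕ) (I : Instance n) (S : List (Op n)) → Feasible S →
    Random.expected I Tparam Eparam ≤ ρ * cost I S
theorem3 n I S = Competitive.competitive Tparam Eparam admissible (toWitness {a? = Tparam ≤? Eparam} _) I
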